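{- Let $k\ge1$ be an integer and $a_1,\dots,a_k,b_1,\dots,b_k$ commuting variables. Set $z_k=a_1\cdots a_k$, $w_k=a_1b_1\cdots a_kb_k$, $x_k=a_1+a_1a_2+\cdots+a_1\cdots a_{k-1}$, $y_k=z_k(b_1+b_1b_2+\cdots+b_1\cdots b_{k-1})$. Then $$\sum_{\pi\in\mathcal{E}^k}\omega^k_\pi\big((a_i),(b_i)\big)=\frac{1}{(w_k;w_k)_\infty},\qquad \sum_{\pi\in\mathcal{S}^k}\omega^k_\pi\big((a_i),(b_i)\big)=\frac{(-x_k,-y_k;w_k)_\infty}{(z_k,w_k;w_k)_\infty},$$ $$\sum_{\pi\in\mathcal{DS}^k}\omega^k_\pi\big((a_i),(b_i)\big)=\frac{(-x_k,-y_k;w_k)_\infty}{(z_k;w_k)_\infty}.$$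
   Context: A partition $\pi$ is $k$-strict if for every $m\in\mathbb{N}$ and all $1\le r_1\le r_2\le k-1$, the numbers $mk+r_1$ and $mk+r_2$ do not appear together as parts of $\pi$ (so at most one part, counted with multiplicity, lies in each block $\{mk+1,\dots,mk+k-1\}$). $\mathcal{S}^k$ is the set of $k$-strict partitions; $\mathcal{DS}^k$ is the set of $k$-strict partitions into distinct parts; $\mathcal{E}^k$ is the set of partitions all of whose parts are $\equiv0\pmod k$ with each part occurring an even number of times. The weight $\omega^k_\pi((a_i),(b_i))$ is the product of labels obtained by labelling cells of each odd-indexed row of the Ferrers diagram of $\pi$ (top row has index 1) from left to right cyclically by $a_1,\dots,a_k$ and of each even-indexed row cyclically by $b_1,\dots,b_k$. Notation: $(a;q)_\infty=\prod_{i\ge1}(1-aq^{i-1})$ and $(a_1,\dots,a_m;q)_\infty=\prod_j(a_j;q)_\infty$; the identities are in formal power series. -}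

module Defs where

open import Level using (Level)
open import Algebra.Bundles using (CommutativeRing)
open import Data.Nat using (ℕ; zero; suc; _∸_; _≡ᵇ_; _<ᵇ_; NonZero) renaming (_+_ to _+ℕ_; _*_ to _*ℕ_)
open import Data.Nat.DivMod using (_mod_; _/_; _%_)
open import Data.Fin using (Fin)
open import Data.Bool using (Bool; true; false; if_then_else_; _∧_; _∨_; not)
open import Data.List using (List; []; _∷_; _++_; concatMap; replicate; upTo; map)

-- Partitions (as weakly decreasing lists of positive parts, largest first)

parts : ℕ → ℕ → List (List ℕ)
parts zero zero = [] ∷ []
parts zero (suc n) = []
parts (suc m) n =
  concatMap (λ c → if (c *ℕ suc m) <ᵇ suc n
                      then map (replicate c (suc m) ++_) (parts m (n ∸ c *ℕ suc m))
                      else [])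
            (upTo (suc n))

partitionsOf : ℕ → List (List ℕ)
partitionsOf n = parts n n

module Classes (k : ℕ) ⦃ nz : NonZero k ⦄ where

  -- p lies in some block {mk+1,…,mk+k-1}
  inBlock : ℕ → Bool
  inBlock p = not (p % k ≡ᵇ 0)

  sameBlock : ℕ → ℕ → Bool
  sameBlock p q = inBlock p ∧ inBlock q ∧ (p / k ≡ᵇ q / k)

  anyL : (ℕ → Bool) → List ℕ → Bool
  anyL f [] = false
  anyL f (x ∷ xs) = f x ∨ anyL f xs

  allL : (ℕ → Bool) → List ℕ → Bool
  allL f [] = true
  allL f (x ∷ xs) = f x ∧ allL f xs

  -- k-strict: no two parts (at distinct positions, i.e. counted with
  -- multiplicity) lie in the same block
  isS : List ℕ → Bool
  isS [] = true
  isS (p ∷ ps) = not (anyL (sameBlock p) ps) ∧ isS ps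

  distinct : List ℕ → Bool
  distinct [] = true
  distinct (p ∷ ps) = not (anyL (λ q → p ≡ᵇ q) ps) ∧ distinct ps

  isDS : List ℕ → Bool
  isDS π = isS π ∧ distinct π

  count : ℕ → List ℕ → ℕ
  count p [] = 0
  count p (q ∷ qs) = (if p ≡ᵇ q then 1 else 0) +ℕ count p qs

  isE : List ℕ → Bool
  isE π = allL (λ p → (p % k ≡ᵇ 0) ∧ (count p π % 2 ≡ᵇ 0)) π

module Series {c ℓ : Level} (R : CommutativeRing c ℓ) where
  open CommutativeRing R

  PS : Set c
  PS = ℕ → Carrier

  _≋_ : PS → PS → Set ℓ
  f ≋ g = ∀ n → f n ≈ g n

  sumTo : ℕ → (ℕ → Carrier) → Carrier
  sumTo zero h = 0#
  sumTo (suc n) h = sumTo n h + h n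

  prodTo : ℕ → (ℕ → Carrier) → Carrier
  prodTo zero h = 1#
  prodTo (suc n) h = prodTo n h * h n

  mono : Carrier → ℕ → PS
  mono x d n = if n ≡ᵇ d then x else 0#

  oneS : PS
  oneS = mono 1# 0

  _⊕_ : PS → PS → PS
  (f ⊕ g) n = f n + g n

  ⊖_ : PS → PS
  (⊖ f) n = - f n

  _⊛_ : PS → PS → PS
  (f ⊛ g) n = sumTo (suc n) (λ i → f i * g (n ∸ i))

  sumS : ℕ → (ℕ → PS) → PS
  sumS zero F = mono 0# 0
  sumS (suc n) F = sumS n F ⊕ F n

  prodS : ℕ → (ℕ → PS) → PS
  prodS zero F = oneS
  prodS (suc n) F = prodS n F ⊛ F n

  powS : PS → ℕ → PS
  powS f j = prodS j (λ _ → f)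

  -- (u;q)_∞ = Π_{j≥0} (1 - u q^j).  Used only when q has zero constant
  -- term and u has zero constant term, so that the factor j is 1 + O(t^{j+1})
  -- and the coefficient of t^n is already determined by the first n+1 factors.
  poch : PS → PS → PS
  poch u q n = prodS (suc n) (λ j → oneS ⊕ (⊖ (u ⊛ powS q j))) n

  -- multiplicative inverse of a power series with constant term 1:
  -- g_0 = 1, g_{n+1} = - Σ_{i=0}^{n} f_{i+1} g_{n-i}.
  -- invList f n = [g_n, g_{n-1}, …, g_0]
  private
    dot : PS → ℕ → List Carrier → Carrier
    dot f i [] = 0#
    dot f i (x ∷ xs) = f (suc i) * x + dot f (suc i) xs

    headOr0 : List Carrier → Carrier
    headOr0 [] = 0#
    headOr0 (x ∷ _) = x

  invList : PS → ℕ → List Carrier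
  invList f zero = 1# ∷ []
  invList f (suc n) = (- dot f 0 (invList f n)) ∷ invList f n

  inv : PS → PS
  inv f n = headOr0 (invList f n)

-- Weights and the series of Theorem 2.5.
-- The variables a_1..a_k, b_1..b_k are a b : Fin k → R (0-indexed), and each
-- variable is graded by t (a_i ↦ a_i t, b_i ↦ b_i t).

module Thm {c ℓ : Level} (R : CommutativeRing c ℓ)
           (k : ℕ) ⦃ nz : NonZero k ⦄ (a b : Fin k → CommutativeRing.Carrier R) where
  open CommutativeRing R
  open Series R

  rowW : (Fin k → Carrier) → ℕ → Carrier
  rowW lab len = prodTo len (λ j → lab (j mod k))

  ωodd ωeven : List ℕ → Carrier
  ωodd [] = 1#
  ωodd (p ∷ ps) = rowW a p * ωeven ps
  ωeven [] = 1#
  ωeven (p ∷ ps) = rowW b p * ωodd ps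

  ω : List ℕ → Carrier
  ω = ωodd

  sumIf : (List ℕ → Bool) → List (List ℕ) → Carrier
  sumIf P [] = 0#
  sumIf P (π ∷ πs) = (if P π then ω π else 0#) + sumIf P πs

  genSeries : (List ℕ → Bool) → PS
  genSeries P n = sumIf P (partitionsOf n)

  ta tb : ℕ → PS
  ta i = mono (a (i mod k)) 1
  tb i = mono (b (i mod k)) 1

  z w x y : PS
  z = prodS k ta
  w = prodS k (λ i → ta i ⊛ tb i)
  x = sumS (k ∸ 1) (λ j → prodS (suc j) ta)
  y = z ⊛ sumS (k ∸ 1) (λ j → prodS (suc j) tb)

{-# OPTIONS --safe #-}
module Submission where

open import Defs
open import Level using (Level)
open import Algebra.Bundles using (CommutativeRing)
open import Data.Nat using (ℕ; zero; suc; _≤_; _<_; z≤n; s≤s; _∸_; _≡ᵇ_; _<ᵇ_; NonZero)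
  renaming (_+_ to _+ℕ_; _*_ to _*ℕ_)
import Data.Nat.Properties as ℕ
open import Data.Nat.DivMod using (_/_; _%_; _mod_; [m+kn]%n≡m%n; m<n⇒m%n≡m; m<n⇒m/n≡0; m*n/n≡m; m*n%n≡0;
  m≡m%n+[m/n]*n; +-distrib-/-∣ʳ)
open import Data.Nat.Divisibility using (n∣m*n)
open import Data.Fin using (Fin)
import Data.Fin.Properties as Fin
open import Data.Bool using (Bool; true; false; if_then_else_; _∧_; _∨_)
open import Data.Bool.Properties using (∧-zeroʳ; T-≡; ¬-not)
open import Data.List using (List; []; _∷_; _++_; concatMap; replicate; applyUpTo; map)
open import Data.List.Relation.Unary.All using (All; []; _∷_)
import Data.List.Relation.Unary.All as All
import Data.List.Relation.Unary.All.Properties as Allₚ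
open import Data.Product using (_×_; _,_)
open import Data.Sum using (_⊎_; inj₁; inj₂)
open import Function using (_∘_)
open import Function.Bundles using (Equivalence)
open import Relation.Nullary using (¬_)
import Relation.Binary.PropositionalEquality as ≡
open ≡ using (_≡_)

-- Let D_M and D′_M be the generating series of the partitions in 𝒟𝒮^k with parts at most Mk, the
-- top row being labelled by the a_i for D_M and by the b_i for D′_M.  With x′ = b_1 + b_1b_2 + ⋯ and
-- z′ = b_1⋯b_k, adding the parts Mk+1, …, (M+1)k gives
--   D_{M+1} = (D_M + z^M x D′_M) + z^{M+1} (D′_M + z′^M x′ D_M)
-- and its mirror image.  In 𝒮^k a part jk can also be repeated; since two copies weigh w^j, this
-- divides D_M by (w;w)_M, and ℰ^k consists of such pairs only.
--
-- The recurrence is solved by the deformation G(n,i) of D_n = G(n,0) under (y,z) ↦ (y w^i, z w^i):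
--   G(n+1,i) = (1 + y w^i) G(n,i+1) + (z w^i + x w^n) G(n,i).
-- (In closed form G(n,i) = Σ_j [n choose j]_w w^{ij} (-x;w)_{n-j} Π_{l<j} (z + y w^l), but only the two
-- Pascal-type recurrences are needed.)  Modulo t^N the sequence n ↦ G(n,i) is constant from n = N on, so the
-- recurrence reads (1 - z w^i) G(N,i) = (1 + y w^i) G(N,i+1), which telescopes from G(N,0) = D_N to
-- G(N,N) = (-x;w)_N.

-- Solving the recurrences in a commutative ring where z and w are nilpotent.

module Recurrence {c ℓ : Level} (A : CommutativeRing c ℓ) where
  open CommutativeRing A
  open Series A using (prodTo)
  open import Algebra.Properties.Ring ring using (-‿distribˡ-*; -‿distribʳ-*; -‿involutive; +-cancelʳ; -0#≈0#)
  open import Algebra.Solver.Ring.NaturalCoefficients.Default commutativeSemiring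
    using (solve; _:=_; _:+_; _:*_; con)
  open import Relation.Binary.Reasoning.Setoid setoid

  pow : Carrier → ℕ → Carrier
  pow u n = prodTo n (λ _ → u)

  factor : Carrier → Carrier → ℕ → Carrier
  factor q u i = 1# + - (u * pow q i)

  pow-cong : ∀ {u v} → u ≈ v → ∀ n → pow u n ≈ pow v n
  pow-cong u≈v zero = refl
  pow-cong u≈v (suc n) = *-cong (pow-cong u≈v n) u≈v

  pow-* : ∀ u v n → pow (u * v) n ≈ pow u n * pow v n
  pow-* u v zero = sym (*-identityˡ 1#)
  pow-* u v (suc n) = trans (*-congʳ (pow-* u v n))
    (solve 4 (λ u v p q → (p :* q) :* (u :* v) := (p :* u) :* (q :* v)) refl u v (pow u n) (pow v n))

  -- Every factor past M is 1. This compares the finite products that stand for one infinite product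
  -- at different truncations.
  prodTo-extend : ∀ q u d M → (∀ j → M ≤ j → pow q j ≈ 0#) →
                  prodTo (d +ℕ M) (factor q u) ≈ prodTo M (factor q u)
  prodTo-extend q u zero M q^j≈0 = refl
  prodTo-extend q u (suc d) M q^j≈0 = begin
    prodTo (d +ℕ M) (factor q u) * factor q u (d +ℕ M)
      ≈⟨ *-cong (prodTo-extend q u d M q^j≈0) (+-congˡ (-‿cong (*-congˡ (q^j≈0 (d +ℕ M) (ℕ.m≤n+m M d))))) ⟩
    prodTo M (factor q u) * (1# + - (u * 0#))
      ≈⟨ *-congˡ (+-congˡ (trans (-‿cong (zeroʳ u)) -0#≈0#)) ⟩
    prodTo M (factor q u) * (1# + 0#)
      ≈⟨ trans (*-congˡ (+-identityʳ 1#)) (*-identityʳ _) ⟩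
    prodTo M (factor q u) ∎

  module Solution (x y z w : Carrier) where

    -- F n i extends w^n G(n, i - 1) to i = 0, where w^{-1} would be needed.
    G F : ℕ → ℕ → Carrier
    G zero i = 1#
    G (suc n) i = (1# + y * pow w i) * G n (suc i) + (z * pow w i + x * pow w n) * G n i
    F zero i = 1#
    F (suc n) i = pow w n * (w + y * pow w i) * G n i + (z * pow w i + x * pow w (suc n)) * F n i

    -- Raising i by one pulls a factor w out of each coefficient of `F`, and what remains is the
    -- recurrence of `G`.
    F-suc : ∀ n i → F n (suc i) ≈ pow w n * G n i
    F-suc zero i = sym (*-identityˡ 1#)
    F-suc (suc n) i = begin
      F (suc n) (suc i) ≈⟨ +-congˡ (*-congˡ (F-suc n i)) ⟩
      p * (w + y * (v * w)) * G n (suc i) + (z * (v * w) + x * (p * w)) * (p * G n i)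
        ≈⟨ solve 8 (λ x y z w v p g₁ g₀ →
             p :* (w :+ y :* (v :* w)) :* g₁ :+ (z :* (v :* w) :+ x :* (p :* w)) :* (p :* g₀)
               := p :* w :* ((con 1 :+ y :* v) :* g₁ :+ (z :* v :+ x :* p) :* g₀))
             refl x y z w v p (G n (suc i)) (G n i) ⟩
      p * w * G (suc n) i ∎
      where p = pow w n ; v = pow w i

    -- The second Pascal-type recurrence. Its case i = 0 has the shape of the step of D_n, whereas
    -- the defining recurrence moves i and drives the telescoping.
    G-step : ∀ n i → G (suc n) i ≈ (1# + y * pow w n * pow w i) * G n i + (x + z * pow w i) * F n i
    G-step zero i =
      solve 4 (λ x y z v → (con 1 :+ y :* v) :* con 1 :+ (z :* v :+ x :* con 1) :* con 1
                 := (con 1 :+ y :* con 1 :* v) :* con 1 :+ (x :+ z :* v) :* con 1)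
            refl x y z (pow w i)
    -- Modulo the ring axioms, the two sides of the claim for suc n differ by μ times those for n.
    G-step (suc n) i = +-cancelʳ (μ * rhs) _ _ (begin
      (1# + y * v) * G (suc n) (suc i) + (z * v + x * (p * w)) * G (suc n) i + μ * rhs
        ≈⟨ +-congʳ (+-congʳ (*-congˡ (trans (G-step n (suc i)) (+-congˡ (*-congˡ (F-suc n i)))))) ⟩
      (1# + y * v) * ((1# + y * p * (v * w)) * g₁ + (x + z * (v * w)) * (p * g₀))
        + (z * v + x * (p * w)) * ((1# + y * v) * g₁ + (z * v + x * p) * g₀) + μ * rhs
        ≈⟨ solve 9 (λ x y z w v p g₁ g₀ f →
             (con 1 :+ y :* v) :* ((con 1 :+ y :* p :* (v :* w)) :* g₁ :+ (x :+ z :* (v :* w)) :* (p :* g₀))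
               :+ (z :* v :+ x :* (p :* w)) :* ((con 1 :+ y :* v) :* g₁ :+ (z :* v :+ x :* p) :* g₀)
               :+ (z :* v :+ x :* (p :* w)) :* ((con 1 :+ y :* p :* v) :* g₀ :+ (x :+ z :* v) :* f)
             := (con 1 :+ y :* (p :* w) :* v) :* ((con 1 :+ y :* v) :* g₁ :+ (z :* v :+ x :* p) :* g₀)
               :+ (x :+ z :* v) :* (p :* (w :+ y :* v) :* g₀ :+ (z :* v :+ x :* (p :* w)) :* f)
               :+ (z :* v :+ x :* (p :* w)) :* ((con 1 :+ y :* v) :* g₁ :+ (z :* v :+ x :* p) :* g₀))
             refl x y z w v p g₁ g₀ (F n i) ⟩
      (1# + y * (p * w) * v) * G (suc n) i + (x + z * v) * F (suc n) i + μ * G (suc n) i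
        ≈⟨ +-congˡ (*-congˡ (G-step n i)) ⟩
      (1# + y * (p * w) * v) * G (suc n) i + (x + z * v) * F (suc n) i + μ * rhs ∎)
      where
      p = pow w n ; v = pow w i ; g₁ = G n (suc i) ; g₀ = G n i
      μ = z * v + x * (p * w)
      rhs = (1# + y * p * v) * G n i + (x + z * v) * F n i

    factor-neg : ∀ u i → factor w (- u) i ≈ 1# + u * pow w i
    factor-neg u i = +-congˡ (trans (-‿cong (sym (-‿distribˡ-* u _))) (-‿involutive _))

    -- Once w^i vanishes, the y and z terms drop out of the recurrence; both remaining values of `G`
    -- are the same product, and each step multiplies it by 1 + x w^n.
    G-large-i : ∀ i → pow w i ≈ 0# → ∀ n → G n i ≈ prodTo n (factor w (- x))
    G-large-i i w^i≈0 zero = refl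
    G-large-i i w^i≈0 (suc n) = begin
      (1# + y * pow w i) * G n (suc i) + (z * pow w i + x * pow w n) * G n i
        ≈⟨ +-cong (*-cong (+-congˡ (*-congˡ w^i≈0)) (G-large-i (suc i) (trans (*-congʳ w^i≈0) (zeroˡ w)) n))
                  (*-cong (+-congʳ (*-congˡ w^i≈0)) (G-large-i i w^i≈0 n)) ⟩
      (1# + y * 0#) * P + (z * 0# + x * pow w n) * P
        ≈⟨ solve 5 (λ x y z p P → (con 1 :+ y :* con 0) :* P :+ (z :* con 0 :+ x :* p) :* P
                      := P :* (con 1 :+ x :* p)) refl x y z (pow w n) P ⟩
      P * (1# + x * pow w n)  ≈⟨ *-congˡ (factor-neg x n) ⟨
      P * factor w (- x) n ∎
      where P = prodTo n (factor w (- x))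

    module Nilpotent (N : ℕ) (w^N≈0 : pow w N ≈ 0#) (F≈0 : ∀ i → F N i ≈ 0#) where

      -- In `G-step` at n = N every correction carries w^N or `F N i`.
      G-stable : ∀ i → G (suc N) i ≈ G N i
      G-stable i = begin
        G (suc N) i  ≈⟨ G-step N i ⟩
        (1# + y * pow w N * pow w i) * G N i + (x + z * pow w i) * F N i
          ≈⟨ +-cong (*-congʳ (+-congˡ (*-congʳ (*-congˡ w^N≈0)))) (*-congˡ (F≈0 i)) ⟩
        (1# + y * 0# * pow w i) * G N i + (x + z * pow w i) * 0#
          ≈⟨ solve 5 (λ x y z v g → (con 1 :+ y :* con 0 :* v) :* g :+ (x :+ z :* v) :* con 0 := g)
                   refl x y z (pow w i) (G N i) ⟩
        G N i ∎

      -- The defining recurrence at n = N, with `G-stable` applied to its left side: w^N = 0 removes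
      -- the x term, and the z term moves across.
      G-shift : ∀ i → factor w z i * G N i ≈ factor w (- y) i * G N (suc i)
      G-shift i = begin
        factor w z i * G N i               ≈⟨ distribʳ _ _ _ ⟩
        1# * G N i + - (z * v) * G N i     ≈⟨ +-congʳ (trans (*-identityˡ _) (sym (G-stable i))) ⟩
        (1# + y * v) * G N (suc i) + (z * v + x * pow w N) * G N i + - (z * v) * G N i
          ≈⟨ +-assoc _ _ _ ⟩
        (1# + y * v) * G N (suc i) + ((z * v + x * pow w N) * G N i + - (z * v) * G N i)
          ≈⟨ +-congˡ (distribʳ _ _ _) ⟨
        (1# + y * v) * G N (suc i) + (z * v + x * pow w N + - (z * v)) * G N i
          ≈⟨ +-congˡ (*-congʳ (+-congʳ (trans (+-congˡ (trans (*-congˡ w^N≈0) (zeroʳ x))) (+-identityʳ _)))) ⟩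
        (1# + y * v) * G N (suc i) + (z * v + - (z * v)) * G N i
          ≈⟨ +-congˡ (trans (*-congʳ (-‿inverseʳ _)) (zeroˡ _)) ⟩
        (1# + y * v) * G N (suc i) + 0#    ≈⟨ +-identityʳ _ ⟩
        (1# + y * v) * G N (suc i)         ≈⟨ *-congʳ (factor-neg y i) ⟨
        factor w (- y) i * G N (suc i) ∎
        where v = pow w i

      -- The relation is kept cross-multiplied, so no inverse of 1 - z w^i is required.
      G-telescope : ∀ i → prodTo i (factor w z) * G N 0 ≈ prodTo i (factor w (- y)) * G N i
      G-telescope zero = refl
      G-telescope (suc i) = begin
        P * f * G N 0    ≈⟨ solve 3 (λ P f g → P :* f :* g := f :* (P :* g)) refl P f (G N 0) ⟩
        f * (P * G N 0)  ≈⟨ *-congˡ (G-telescope i) ⟩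
        f * (Q * G N i)  ≈⟨ solve 3 (λ Q f g → f :* (Q :* g) := Q :* (f :* g)) refl Q f (G N i) ⟩
        Q * (f * G N i)  ≈⟨ *-congˡ (G-shift i) ⟩
        Q * (factor w (- y) i * G N (suc i))  ≈⟨ *-assoc _ _ _ ⟨
        Q * factor w (- y) i * G N (suc i) ∎
        where
        P = prodTo i (factor w z) ; Q = prodTo i (factor w (- y)) ; f = factor w z i

      G-product : prodTo N (factor w z) * G N 0 ≈ prodTo N (factor w (- x)) * prodTo N (factor w (- y))
      G-product = trans (G-telescope N) (trans (*-congˡ (G-large-i N w^N≈0 N)) (*-comm _ _))

  -- The first bracket allows at most one part strictly between nk and (n+1)k. The second puts the
  -- part (n+1)k on top of such a partition, whose rows then carry the exchanged labels.
  CoupledStep : (x x′ z z′ : Carrier) (D D′ : ℕ → Carrier) → Set ℓ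
  CoupledStep x x′ z z′ D D′ = ∀ n →
    D (suc n) ≈ (D n + pow z n * x * D′ n) + pow z (suc n) * (D′ n + pow z′ n * x′ * D n)

  -- z^n D′ n rather than D′ n obeys a recurrence free of z′: it is F n 0.
  module Coupled (x x′ z z′ w : Carrier) (w≈zz′ : w ≈ z * z′) (D D′ : ℕ → Carrier)
                 (D₀≈1 : D 0 ≈ 1#) (D′₀≈1 : D′ 0 ≈ 1#)
                 (D-step : CoupledStep x x′ z z′ D D′) (D′-step : CoupledStep x′ x z′ z D′ D) where

    y : Carrier
    y = z * x′

    open Solution x y z w

    w^≈ : ∀ n → pow w n ≈ pow z n * pow z′ n
    w^≈ n = trans (pow-cong w≈zz′ n) (pow-* z z′ n)

    D≈G : ∀ n → D n ≈ G n 0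
    D′≈F : ∀ n → pow z n * D′ n ≈ F n 0
    D≈G zero = D₀≈1
    D≈G (suc n) = begin
      D (suc n)  ≈⟨ D-step n ⟩
      (D n + a * x * D′ n) + a * z * (D′ n + b * x′ * D n)
        ≈⟨ solve 7 (λ x x′ z a b d d′ →
             (d :+ a :* x :* d′) :+ a :* z :* (d′ :+ b :* x′ :* d)
               := (con 1 :+ z :* x′ :* (a :* b) :* con 1) :* d :+ (x :+ z :* con 1) :* (a :* d′))
             refl x x′ z a b (D n) (D′ n) ⟩
      (1# + y * (a * b) * 1#) * D n + (x + z * 1#) * (a * D′ n)
        ≈⟨ +-cong (*-cong (+-congˡ (*-congʳ (*-congˡ (sym (w^≈ n))))) (D≈G n)) (*-congˡ (D′≈F n)) ⟩
      (1# + y * pow w n * 1#) * G n 0 + (x + z * 1#) * F n 0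
        ≈⟨ G-step n 0 ⟨
      G (suc n) 0 ∎
      where a = pow z n ; b = pow z′ n
    D′≈F zero = trans (*-identityˡ _) D′₀≈1
    D′≈F (suc n) = begin
      a * z * D′ (suc n)  ≈⟨ *-congˡ (D′-step n) ⟩
      a * z * ((D′ n + b * x′ * D n) + b * z′ * (D n + a * x * D′ n))
        ≈⟨ solve 8 (λ x x′ z z′ a b d d′ →
             a :* z :* ((d′ :+ b :* x′ :* d) :+ b :* z′ :* (d :+ a :* x :* d′))
               := (a :* b) :* (z :* z′ :+ z :* x′ :* con 1) :* d
                  :+ (z :* con 1 :+ x :* ((a :* b) :* (z :* z′))) :* (a :* d′))
             refl x x′ z z′ a b (D n) (D′ n) ⟩
      (a * b) * (z * z′ + y * 1#) * D n + (z * 1# + x * ((a * b) * (z * z′))) * (a * D′ n)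
        ≈⟨ +-cong (*-cong (*-cong (sym (w^≈ n)) (+-congʳ (sym w≈zz′))) (D≈G n))
                  (*-cong (+-congˡ (*-congˡ (*-cong (sym (w^≈ n)) (sym w≈zz′)))) (D′≈F n)) ⟩
      F (suc n) 0 ∎
      where a = pow z n ; b = pow z′ n

    limit : ∀ N → pow z N ≈ 0# →
            prodTo N (factor w z) * D N ≈ prodTo N (factor w (- x)) * prodTo N (factor w (- y))
    limit N z^N≈0 = trans (*-congˡ (D≈G N)) (Nilpotent.G-product N w^N≈0 F≈0)
      where
      w^N≈0 : pow w N ≈ 0#
      w^N≈0 = trans (w^≈ N) (trans (*-congʳ z^N≈0) (zeroˡ _))
      F≈0 : ∀ i → F N i ≈ 0#
      -- `F-suc` covers only positive i; at i = 0 the vanishing comes from z^N D′_N instead.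
      F≈0 zero = trans (sym (D′≈F N)) (trans (*-congʳ z^N≈0) (zeroˡ _))
      F≈0 (suc i) = trans (F-suc N i) (trans (*-congʳ w^N≈0) (zeroˡ _))

  -- Repeated multiples of k: clearing the denominator (w;w)_M.

  clear-geometric : ∀ {s e u} → s ≈ e + u * s → s * (1# + - u) ≈ e
  clear-geometric {s} {e} {u} s≈e+us = begin
    s * (1# + - u)           ≈⟨ distribˡ s 1# (- u) ⟩
    s * 1# + s * - u         ≈⟨ +-cong (trans (*-identityʳ s) s≈e+us)
                                       (trans (sym (-‿distribʳ-* s u)) (-‿cong (*-comm s u))) ⟩
    e + u * s + - (u * s)    ≈⟨ +-assoc _ _ _ ⟩
    e + (u * s + - (u * s))  ≈⟨ +-congˡ (-‿inverseʳ _) ⟩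
    e + 0#                   ≈⟨ +-identityʳ e ⟩
    e ∎

  -- Below a top part (n+1)k the same part may occur again, so the last term involves S′ at n+1
  -- rather than at n.
  ImplicitStep : (x z : Carrier) (S S′ : ℕ → Carrier) → Set ℓ
  ImplicitStep x z S S′ = ∀ n → S (suc n) ≈ (S n + pow z n * x * S′ n) + pow z (suc n) * S′ (suc n)

  module Clearing (z z′ w : Carrier) (w≈zz′ : w ≈ z * z′) where

    factor≈ : ∀ n → factor w w n ≈ 1# + - (pow z (suc n) * pow z′ (suc n))
    factor≈ n = +-congˡ (-‿cong (trans (*-comm w _) (trans (pow-cong w≈zz′ (suc n)) (pow-* z z′ (suc n)))))

    cleared : (ℕ → Carrier) → ℕ → Carrier
    cleared S n = S n * prodTo n (factor w w)

    -- Substituting the mirror-image step into the step returns to `S (suc n)` with coefficient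
    -- z^{n+1} z′^{n+1} = w^{n+1}, which is exactly what the new factor 1 - w^{n+1} clears. The
    -- earlier factors pass through by linearity.
    cleared-step : ∀ {x x′ S S′} → ImplicitStep x z S S′ → ImplicitStep x′ z′ S′ S →
                   CoupledStep x x′ z z′ (cleared S) (cleared S′)
    cleared-step {x} {x′} {S} {S′} S-step S′-step n = begin
      S (suc n) * (P * factor w w n)
        ≈⟨ trans (*-congˡ (*-comm _ _)) (sym (*-assoc _ _ _)) ⟩
      S (suc n) * factor w w n * P
        ≈⟨ *-congʳ (trans (*-congˡ (factor≈ n)) (clear-geometric S≈)) ⟩
      (h + a * z * h′) * P
        ≈⟨ solve 8 (λ x x′ z a b s s′ P →
             ((s :+ a :* x :* s′) :+ a :* z :* (s′ :+ b :* x′ :* s)) :* P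
               := (s :* P :+ a :* x :* (s′ :* P)) :+ a :* z :* (s′ :* P :+ b :* x′ :* (s :* P)))
             refl x x′ z a b (S n) (S′ n) P ⟩
      (S n * P + a * x * (S′ n * P)) + a * z * (S′ n * P + b * x′ * (S n * P)) ∎
      where
      P = prodTo n (factor w w) ; a = pow z n ; b = pow z′ n
      h = S n + a * x * S′ n
      h′ = S′ n + b * x′ * S n
      S≈ : S (suc n) ≈ (h + a * z * h′) + a * z * (b * z′) * S (suc n)
      S≈ = trans (S-step n) (trans (+-congˡ (*-congˡ (S′-step n)))
        (solve 5 (λ h h′ p q s → h :+ p :* (h′ :+ q :* s) := (h :+ p :* h′) :+ p :* q :* s)
               refl h h′ (a * z) (b * z′) (S (suc n))))

    -- The version for ℰ^k: with pairs of equal parts only, there is no block term, and the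
    -- geometric factors are all of the series.
    cleared-constant : ∀ {S} → S 0 ≈ 1# →
      (∀ n → S (suc n) ≈ S n + pow z (suc n) * pow z′ (suc n) * S (suc n)) → ∀ n → cleared S n ≈ 1#
    cleared-constant S₀≈1 S-step zero = trans (*-identityʳ _) S₀≈1
    cleared-constant {S} S₀≈1 S-step (suc n) = begin
      S (suc n) * (P * factor w w n)
        ≈⟨ trans (*-congˡ (*-comm _ _)) (sym (*-assoc _ _ _)) ⟩
      S (suc n) * factor w w n * P
        ≈⟨ *-congʳ (trans (*-congˡ (factor≈ n)) (clear-geometric (S-step n))) ⟩
      S n * P  ≈⟨ cleared-constant S₀≈1 S-step n ⟩
      1# ∎
      where P = prodTo n (factor w w)

-- Formal power series, their truncations and inverses.

module PowerSeries {c ℓ : Level} (R : CommutativeRing c ℓ) where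
  open CommutativeRing R
  open Series R
  open import Algebra.Properties.Ring ring using (-0#≈0#)
  open import Algebra.Properties.CommutativeSemigroup +-commutativeSemigroup using (interchange)
  open import Relation.Binary.Reasoning.Setoid setoid

  sumTo-cong< : ∀ n {g h} → (∀ i → i < n → g i ≈ h i) → sumTo n g ≈ sumTo n h
  sumTo-cong< zero g≈h = refl
  sumTo-cong< (suc n) g≈h = +-cong (sumTo-cong< n λ i i<n → g≈h i (ℕ.m<n⇒m<1+n i<n)) (g≈h n ℕ.≤-refl)

  sumTo-cong : ∀ n {g h} → (∀ i → g i ≈ h i) → sumTo n g ≈ sumTo n h
  sumTo-cong n g≈h = sumTo-cong< n λ i _ → g≈h i

  sumTo-+ : ∀ n g h → sumTo n (λ i → g i + h i) ≈ sumTo n g + sumTo n h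
  sumTo-+ zero g h = sym (+-identityˡ 0#)
  sumTo-+ (suc n) g h = trans (+-congʳ (sumTo-+ n g h)) (interchange _ _ _ _)

  sumTo-*ˡ : ∀ n r h → sumTo n (λ i → r * h i) ≈ r * sumTo n h
  sumTo-*ˡ zero r h = sym (zeroʳ r)
  sumTo-*ˡ (suc n) r h = trans (+-congʳ (sumTo-*ˡ n r h)) (sym (distribˡ _ _ _))

  sumTo-zero : ∀ n → sumTo n (λ _ → 0#) ≈ 0#
  sumTo-zero zero = refl
  sumTo-zero (suc n) = trans (+-identityʳ _) (sumTo-zero n)

  sumTo-first : ∀ n h → sumTo (suc n) h ≈ h 0 + sumTo n (λ i → h (suc i))
  sumTo-first zero h = +-comm _ _
  sumTo-first (suc n) h = trans (+-congʳ (sumTo-first n h)) (+-assoc _ _ _)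

  tail : PS → PS
  tail f n = f (suc n)

  ⊛-cong< : ∀ N {f g h e} → (∀ i → i < N → f i ≈ g i) → (∀ i → i < N → h i ≈ e i) →
            ∀ i → i < N → (f ⊛ h) i ≈ (g ⊛ e) i
  ⊛-cong< N f≈g h≈e i i<N = sumTo-cong< (suc i) λ { j (s≤s j≤i) →
    *-cong (f≈g j (ℕ.≤-<-trans j≤i i<N)) (h≈e (i ∸ j) (ℕ.≤-<-trans (ℕ.m∸n≤m i j) i<N)) }

  ⊛-cong : ∀ {f g h e} → f ≋ g → h ≋ e → (f ⊛ h) ≋ (g ⊛ e)
  ⊛-cong f≈g h≈e n = ⊛-cong< (suc n) (λ i _ → f≈g i) (λ i _ → h≈e i) n ℕ.≤-refl

  ⊛-zero : ∀ f g → (f ⊛ g) 0 ≈ f 0 * g 0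
  ⊛-zero f g = +-identityˡ _

  -- Peeling off the first summand here, and the last one in `⊛-sucʳ`, turns the ring laws into
  -- inductions on the degree and avoids reindexing double sums.
  ⊛-sucˡ : ∀ f g n → (f ⊛ g) (suc n) ≈ f 0 * g (suc n) + (tail f ⊛ g) n
  ⊛-sucˡ f g n = sumTo-first (suc n) _

  ⊛-sucʳ : ∀ f g n → (f ⊛ g) (suc n) ≈ (f ⊛ tail g) n + f (suc n) * g 0
  ⊛-sucʳ f g n = +-cong
    (sumTo-cong< (suc n) λ { i (s≤s i≤n) → *-congˡ (reflexive (≡.cong g (ℕ.+-∸-assoc 1 i≤n))) })
    (*-congˡ (reflexive (≡.cong g (ℕ.n∸n≡0 n))))

  ⊛-comm : ∀ f g → (f ⊛ g) ≋ (g ⊛ f)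
  ⊛-comm f g zero = trans (⊛-zero f g) (trans (*-comm _ _) (sym (⊛-zero g f)))
  ⊛-comm f g (suc n) = begin
    (f ⊛ g) (suc n)                     ≈⟨ ⊛-sucˡ f g n ⟩
    f 0 * g (suc n) + (tail f ⊛ g) n    ≈⟨ +-cong (*-comm _ _) (⊛-comm (tail f) g n) ⟩
    g (suc n) * f 0 + (g ⊛ tail f) n    ≈⟨ +-comm _ _ ⟩
    (g ⊛ tail f) n + g (suc n) * f 0    ≈⟨ ⊛-sucʳ g f n ⟨
    (g ⊛ f) (suc n) ∎

  ⊛-distribʳ : ∀ f g h → ((g ⊕ h) ⊛ f) ≋ ((g ⊛ f) ⊕ (h ⊛ f))
  ⊛-distribʳ f g h n = trans (sumTo-cong (suc n) λ i → distribʳ _ _ _) (sumTo-+ (suc n) _ _)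

  ⊛-distribˡ : ∀ f g h → (f ⊛ (g ⊕ h)) ≋ ((f ⊛ g) ⊕ (f ⊛ h))
  ⊛-distribˡ f g h n = trans (sumTo-cong (suc n) λ i → distribˡ _ _ _) (sumTo-+ (suc n) _ _)

  ⊛-scaleˡ : ∀ r f g → ((λ n → r * f n) ⊛ g) ≋ (λ n → r * (f ⊛ g) n)
  ⊛-scaleˡ r f g n = trans (sumTo-cong (suc n) λ i → *-assoc _ _ _) (sumTo-*ˡ (suc n) r _)

  ⊛-assoc : ∀ f g h → ((f ⊛ g) ⊛ h) ≋ (f ⊛ (g ⊛ h))
  ⊛-assoc f g h zero = begin
    ((f ⊛ g) ⊛ h) 0      ≈⟨ ⊛-zero (f ⊛ g) h ⟩
    (f ⊛ g) 0 * h 0      ≈⟨ *-congʳ (⊛-zero f g) ⟩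
    f 0 * g 0 * h 0      ≈⟨ *-assoc _ _ _ ⟩
    f 0 * (g 0 * h 0)    ≈⟨ *-congˡ (⊛-zero g h) ⟨
    f 0 * (g ⊛ h) 0      ≈⟨ ⊛-zero f (g ⊛ h) ⟨
    (f ⊛ (g ⊛ h)) 0 ∎
  ⊛-assoc f g h (suc n) = begin
    ((f ⊛ g) ⊛ h) (suc n)
      ≈⟨ ⊛-sucˡ (f ⊛ g) h n ⟩
    (f ⊛ g) 0 * h (suc n) + (tail (f ⊛ g) ⊛ h) n
      ≈⟨ +-cong (trans (*-congʳ (⊛-zero f g)) (*-assoc _ _ _))
                (⊛-cong {h = h} (⊛-sucˡ f g) (λ _ → refl) n) ⟩
    f 0 * (g 0 * h (suc n)) + (((λ i → f 0 * g (suc i)) ⊕ (tail f ⊛ g)) ⊛ h) n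
      ≈⟨ +-congˡ (⊛-distribʳ h _ _ n) ⟩
    f 0 * (g 0 * h (suc n)) + (((λ i → f 0 * g (suc i)) ⊛ h) n + ((tail f ⊛ g) ⊛ h) n)
      ≈⟨ +-congˡ (+-cong (⊛-scaleˡ (f 0) (tail g) h n) (⊛-assoc (tail f) g h n)) ⟩
    f 0 * (g 0 * h (suc n)) + (f 0 * (tail g ⊛ h) n + (tail f ⊛ (g ⊛ h)) n)
      ≈⟨ +-assoc _ _ _ ⟨
    f 0 * (g 0 * h (suc n)) + f 0 * (tail g ⊛ h) n + (tail f ⊛ (g ⊛ h)) n
      ≈⟨ +-congʳ (trans (sym (distribˡ _ _ _)) (*-congˡ (sym (⊛-sucˡ g h n)))) ⟩
    f 0 * (g ⊛ h) (suc n) + (tail f ⊛ (g ⊛ h)) n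
      ≈⟨ ⊛-sucˡ f (g ⊛ h) n ⟨
    (f ⊛ (g ⊛ h)) (suc n) ∎

  -- Multiplication by t^d, by recursion instead of subtraction so that it reduces on constructors.
  shift : ℕ → PS → PS
  shift zero f n = f n
  shift (suc d) f zero = 0#
  shift (suc d) f (suc n) = shift d f n

  mono-⊛ : ∀ r d f n → (mono r d ⊛ f) n ≈ r * shift d f n
  mono-⊛ r zero f zero = ⊛-zero (mono r 0) f
  mono-⊛ r zero f (suc n) = begin
    (mono r 0 ⊛ f) (suc n)             ≈⟨ ⊛-sucˡ (mono r 0) f n ⟩
    r * f (suc n) + ((λ _ → 0#) ⊛ f) n ≈⟨ +-congˡ (trans (sumTo-cong (suc n) λ _ → zeroˡ _) (sumTo-zero (suc n))) ⟩
    r * f (suc n) + 0#                 ≈⟨ +-identityʳ _ ⟩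
    r * f (suc n) ∎
  mono-⊛ r (suc d) f zero = trans (⊛-zero (mono r (suc d)) f) (trans (zeroˡ _) (sym (zeroʳ r)))
  mono-⊛ r (suc d) f (suc n) = begin
    (mono r (suc d) ⊛ f) (suc n)                   ≈⟨ ⊛-sucˡ (mono r (suc d)) f n ⟩
    0# * f (suc n) + (mono r d ⊛ f) n              ≈⟨ +-cong (zeroˡ _) (mono-⊛ r d f n) ⟩
    0# + r * shift d f n                           ≈⟨ +-identityˡ _ ⟩
    r * shift d f n ∎

  ⊛-identityˡ : ∀ f → (oneS ⊛ f) ≋ f
  ⊛-identityˡ f n = trans (mono-⊛ 1# 0 f n) (*-identityˡ _)

  mono-0# : ∀ d n → mono 0# d n ≈ 0#
  mono-0# zero zero = refl
  mono-0# zero (suc n) = refl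
  mono-0# (suc d) zero = refl
  mono-0# (suc d) (suc n) = mono-0# d n

  mono-mono : ∀ r d s e → (mono r d ⊛ mono s e) ≋ mono (r * s) (d +ℕ e)
  mono-mono r d s e n = trans (mono-⊛ r d (mono s e) n) (go d n)
    where
    go : ∀ d n → r * shift d (mono s e) n ≈ mono (r * s) (d +ℕ e) n
    go zero n with n ≡ᵇ e
    ... | true = refl
    ... | false = zeroʳ r
    go (suc d) zero = zeroʳ r
    go (suc d) (suc n) = go d n

  module _ (N : ℕ) where

    _≋<_ : PS → PS → Set ℓ
    f ≋< g = ∀ i → i < N → f i ≈ g i

    -- Series modulo t^N: only the equality is weakened, so elements and operations are literally
    -- the same for every N and results at different N can be compared. Series without constant term
    -- become nilpotent here.
    truncatedRing : CommutativeRing c ℓ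
    truncatedRing = record
      { Carrier = PS ; _≈_ = _≋<_ ; _+_ = _⊕_ ; _*_ = _⊛_ ; -_ = ⊖_
      ; 0# = mono 0# 0 ; 1# = oneS
      ; isCommutativeRing = record
        { isRing = record
          { +-isAbelianGroup = record
            { isGroup = record
              { isMonoid = record
                { isSemigroup = record
                  { isMagma = record
                    { isEquivalence = record
                      { refl = λ _ _ → refl
                      ; sym = λ p i i<N → sym (p i i<N)
                      ; trans = λ p q i i<N → trans (p i i<N) (q i i<N) }
                    ; ∙-cong = λ p q i i<N → +-cong (p i i<N) (q i i<N) }
                  ; assoc = λ f g h i _ → +-assoc _ _ _ }
                ; identity = (λ f i _ → trans (+-congʳ (mono-0# 0 i)) (+-identityˡ _))
                           , (λ f i _ → trans (+-congˡ (mono-0# 0 i)) (+-identityʳ _)) }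
              ; inverse = (λ f i _ → trans (-‿inverseˡ _) (sym (mono-0# 0 i)))
                        , (λ f i _ → trans (-‿inverseʳ _) (sym (mono-0# 0 i)))
              ; ⁻¹-cong = λ p i i<N → -‿cong (p i i<N) }
            ; comm = λ f g i _ → +-comm _ _ }
          ; *-cong = ⊛-cong< N
          ; *-assoc = λ f g h i _ → ⊛-assoc f g h i
          ; *-identity = (λ f i _ → ⊛-identityˡ f i)
                       , (λ f i _ → trans (⊛-comm f oneS i) (⊛-identityˡ f i))
          ; distrib = (λ f g h i _ → ⊛-distribˡ f g h i) , (λ f g h i _ → ⊛-distribʳ f g h i) }
        ; *-comm = λ f g i _ → ⊛-comm f g i } }

  -- A copy of the private function dot behind inv, which dot-unique identifies with the original.
  seriesDot : PS → ℕ → List Carrier → Carrier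
  seriesDot f i [] = 0#
  seriesDot f i (u ∷ us) = f (suc i) * u + seriesDot f (suc i) us

  dot-unique : ∀ {f} (dot : ℕ → List Carrier → Carrier) → (∀ i → dot i [] ≡ 0#) →
               (∀ i u us → dot i (u ∷ us) ≡ f (suc i) * u + dot (suc i) us) →
               ∀ i us → dot i us ≡ seriesDot f i us
  dot-unique dot nil cons i [] = nil i
  dot-unique {f} dot nil cons i (u ∷ us) =
    ≡.trans (cons i u us) (≡.cong (f (suc i) * u +_) (dot-unique dot nil cons (suc i) us))

  -- Abstracting 0 and the list makes the private function the pattern-unification solution for _.
  inv-suc : ∀ f n → inv f (suc n) ≡ - seriesDot f 0 (invList f n)
  inv-suc f n with dot-unique {f} _ (λ _ → ≡.refl) (λ _ _ _ → ≡.refl) | 0 | invList f n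
  ... | unique | i | us = ≡.cong -_ (unique i us)

  seriesDot-tail : ∀ f i us → seriesDot f (suc i) us ≡ seriesDot (tail f) i us
  seriesDot-tail f i [] = ≡.refl
  seriesDot-tail f i (u ∷ us) = ≡.cong (f (suc (suc i)) * u +_) (seriesDot-tail f (suc i) us)

  -- `invList g n` lists the coefficients of `inv g` from degree n down to 0, so pairing it with
  -- f_1, f_2, ... is a convolution with `tail f`.
  seriesDot-⊛ : ∀ f g n → seriesDot f 0 (invList g n) ≈ (tail f ⊛ inv g) n
  seriesDot-⊛ f g zero = +-comm _ _
  seriesDot-⊛ f g (suc n) = begin
    f 1 * inv g (suc n) + seriesDot f 1 (invList g n)
      ≈⟨ +-congˡ (trans (reflexive (seriesDot-tail f 0 (invList g n))) (seriesDot-⊛ (tail f) g n)) ⟩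
    f 1 * inv g (suc n) + (tail (tail f) ⊛ inv g) n
      ≈⟨ ⊛-sucˡ (tail f) (inv g) n ⟨
    (tail f ⊛ inv g) (suc n) ∎

  ⊛-inverseʳ : ∀ f → f 0 ≈ 1# → (f ⊛ inv f) ≋ oneS
  ⊛-inverseʳ f f₀≈1 zero = trans (⊛-zero f (inv f)) (trans (*-identityʳ _) f₀≈1)
  ⊛-inverseʳ f f₀≈1 (suc n) = begin
    (f ⊛ inv f) (suc n)                             ≈⟨ ⊛-sucˡ f (inv f) n ⟩
    f 0 * inv f (suc n) + (tail f ⊛ inv f) n        ≈⟨ +-congʳ (trans (*-congʳ f₀≈1) (*-identityˡ _)) ⟩
    inv f (suc n) + (tail f ⊛ inv f) n              ≈⟨ +-cong (reflexive (inv-suc f n)) (sym (seriesDot-⊛ f f n)) ⟩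
    - seriesDot f 0 (invList f n) + seriesDot f 0 (invList f n) ≈⟨ -‿inverseˡ _ ⟩
    0# ∎

  -- Reduces each identity to its form with cleared denominator.
  inv-unique : ∀ f g h → f 0 ≈ 1# → (f ⊛ g) ≋ h → g ≋ (h ⊛ inv f)
  inv-unique f g h f₀≈1 fg≈h n = begin
    g n                    ≈⟨ ⊛-identityˡ g n ⟨
    (oneS ⊛ g) n           ≈⟨ ⊛-cong {h = g} (λ i → sym (⊛-inverseʳ f f₀≈1 i)) (λ _ → refl) n ⟩
    ((f ⊛ inv f) ⊛ g) n    ≈⟨ ⊛-cong {h = g} (⊛-comm f (inv f)) (λ _ → refl) n ⟩
    ((inv f ⊛ f) ⊛ g) n    ≈⟨ ⊛-assoc (inv f) f g n ⟩
    (inv f ⊛ (f ⊛ g)) n    ≈⟨ ⊛-cong {f = inv f} (λ _ → refl) fg≈h n ⟩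
    (inv f ⊛ h) n          ≈⟨ ⊛-comm (inv f) h n ⟩
    (h ⊛ inv f) n ∎

-- Generating series of partitions by largest part.

module PartitionSums {c ℓ : Level} (R : CommutativeRing c ℓ) where
  open CommutativeRing R
  open Series R
  open PowerSeries R
  open import Relation.Binary.Reasoning.Setoid setoid

  sumL : (List ℕ → Carrier) → List (List ℕ) → Carrier
  sumL φ [] = 0#
  sumL φ (π ∷ πs) = φ π + sumL φ πs

  -- The summand φ encodes both the class and the weight, so removing the top row p just replaces φ
  -- by `φ ∘ (p ∷_)`.
  gf : (List ℕ → Carrier) → ℕ → PS
  gf φ m n = sumL φ (parts m n)

  sumL-++ : ∀ φ πs ρs → sumL φ (πs ++ ρs) ≈ sumL φ πs + sumL φ ρs
  sumL-++ φ [] ρs = sym (+-identityˡ _)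
  sumL-++ φ (π ∷ πs) ρs = trans (+-congˡ (sumL-++ φ πs ρs)) (sym (+-assoc _ _ _))

  sumL-map : ∀ φ (g : List ℕ → List ℕ) πs → sumL φ (map g πs) ≈ sumL (φ ∘ g) πs
  sumL-map φ g [] = refl
  sumL-map φ g (π ∷ πs) = +-congˡ (sumL-map φ g πs)

  sumL-concatMap : ∀ φ (h : ℕ → List (List ℕ)) f n →
    sumL φ (concatMap h (applyUpTo f n)) ≈ sumTo n (λ c → sumL φ (h (f c)))
  sumL-concatMap φ h f zero = refl
  sumL-concatMap φ h f (suc n) = begin
    sumL φ (h (f 0) ++ concatMap h (applyUpTo (f ∘ suc) n))
      ≈⟨ sumL-++ φ (h (f 0)) _ ⟩
    sumL φ (h (f 0)) + sumL φ (concatMap h (applyUpTo (f ∘ suc) n))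
      ≈⟨ +-congˡ (sumL-concatMap φ h (f ∘ suc) n) ⟩
    sumL φ (h (f 0)) + sumTo n (λ c → sumL φ (h (f (suc c))))
      ≈⟨ sumTo-first n _ ⟨
    sumTo (suc n) (λ c → sumL φ (h (f c))) ∎

  sumL-scale : ∀ r φ πs → sumL (λ π → r * φ π) πs ≈ r * sumL φ πs
  sumL-scale r φ [] = sym (zeroʳ r)
  sumL-scale r φ (π ∷ πs) = trans (+-congˡ (sumL-scale r φ πs)) (sym (distribˡ _ _ _))

  sumL-zero : ∀ πs → sumL (λ _ → 0#) πs ≈ 0#
  sumL-zero [] = refl
  sumL-zero (π ∷ πs) = trans (+-identityˡ _) (sumL-zero πs)

  shift-cong< : ∀ d {f g} n → (∀ i → i +ℕ d ≤ n → f i ≈ g i) → shift d f n ≈ shift d g n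
  shift-cong< zero n f≈g = f≈g n (ℕ.≤-reflexive (ℕ.+-identityʳ n))
  shift-cong< (suc d) zero f≈g = refl
  shift-cong< (suc d) (suc n) f≈g =
    shift-cong< d n λ i i+d≤n → f≈g i (≡.subst (_≤ suc n) (≡.sym (ℕ.+-suc i d)) (s≤s i+d≤n))

  shift-cong : ∀ d {f g} → f ≋ g → shift d f ≋ shift d g
  shift-cong d f≈g n = shift-cong< d n λ i _ → f≈g i

  shift-small : ∀ d f n → n < d → shift d f n ≈ 0#
  shift-small (suc d) f zero n<d = refl
  shift-small (suc d) f (suc n) (s≤s n<d) = shift-small d f n n<d

  shift-+ : ∀ d e f n → shift (d +ℕ e) f n ≡ shift d (shift e f) n
  shift-+ zero e f n = ≡.refl
  shift-+ (suc d) e f zero = ≡.refl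
  shift-+ (suc d) e f (suc n) = shift-+ d e f n

  shift-if : ∀ d f n → (if d <ᵇ suc n then f (n ∸ d) else 0#) ≡ shift d f n
  shift-if zero f n = ≡.refl
  shift-if (suc d) f zero = ≡.refl
  shift-if (suc d) f (suc n) = shift-if d f n

  shift-sumTo : ∀ d M (f : ℕ → PS) n →
    shift d (λ i → sumTo M (λ c → f c i)) n ≈ sumTo M (λ c → shift d (f c) n)
  shift-sumTo zero M f n = refl
  shift-sumTo (suc d) M f zero = sym (sumTo-zero M)
  shift-sumTo (suc d) M f (suc n) = shift-sumTo d M f n

  sumTo-extend : ∀ d M h → (∀ c → M ≤ c → h c ≈ 0#) → sumTo (d +ℕ M) h ≈ sumTo M h
  sumTo-extend zero M h h≈0 = refl
  sumTo-extend (suc d) M h h≈0 =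
    trans (+-cong (sumTo-extend d M h h≈0) (h≈0 (d +ℕ M) (ℕ.m≤n+m M d))) (+-identityʳ _)

  gf-multiplicity : ∀ φ m n →
    gf φ (suc m) n ≈ sumTo (suc n) (λ c → shift (c *ℕ suc m) (gf (φ ∘ (replicate c (suc m) ++_)) m) n)
  gf-multiplicity φ m n = trans (sumL-concatMap φ branch (λ c → c) (suc n)) (sumTo-cong (suc n) λ c →
    trans (sumL-if c) (reflexive (shift-if (c *ℕ suc m) (gf (φ ∘ (replicate c (suc m) ++_)) m) n)))
    where
    branch : ℕ → List (List ℕ)
    branch c = if (c *ℕ suc m) <ᵇ suc n then map (replicate c (suc m) ++_) (parts m (n ∸ c *ℕ suc m)) else []
    sumL-if : ∀ c → sumL φ (branch c) ≈
      (if (c *ℕ suc m) <ᵇ suc n then gf (φ ∘ (replicate c (suc m) ++_)) m (n ∸ c *ℕ suc m) else 0#)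
    sumL-if c with (c *ℕ suc m) <ᵇ suc n
    ... | true = sumL-map φ (replicate c (suc m) ++_) (parts m (n ∸ c *ℕ suc m))
    ... | false = refl

  gf-cong : ∀ m {φ ψ} → (∀ π → All (_≤ m) π → φ π ≈ ψ π) → gf φ m ≋ gf ψ m
  gf-cong zero φ≈ψ zero = +-congʳ (φ≈ψ [] [])
  gf-cong zero φ≈ψ (suc n) = refl
  gf-cong (suc m) {φ} {ψ} φ≈ψ n = begin
    gf φ (suc m) n
      ≈⟨ gf-multiplicity φ m n ⟩
    sumTo (suc n) (λ c → shift (c *ℕ suc m) (gf (φ ∘ (replicate c (suc m) ++_)) m) n)
      ≈⟨ (sumTo-cong (suc n) λ c → shift-cong (c *ℕ suc m) (gf-cong m λ π π≤m →
           φ≈ψ (replicate c (suc m) ++ π) (Allₚ.++⁺ (Allₚ.replicate⁺ c ℕ.≤-refl) (All.map ℕ.m≤n⇒m≤1+n π≤m))) n) ⟩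
    sumTo (suc n) (λ c → shift (c *ℕ suc m) (gf (ψ ∘ (replicate c (suc m) ++_)) m) n)
      ≈⟨ gf-multiplicity ψ m n ⟨
    gf ψ (suc m) n ∎

  -- Trades multiplicities for single rows: either m+1 does not occur, or one copy is removed and
  -- further copies may follow. The terms of multiplicity c+1 become those of multiplicity c after
  -- the shift.
  gf-suc : ∀ φ m n → gf φ (suc m) n ≈ gf φ m n + shift (suc m) (gf (φ ∘ (suc m ∷_)) (suc m)) n
  gf-suc φ m n = begin
    gf φ (suc m) n
      ≈⟨ gf-multiplicity φ m n ⟩
    sumTo (suc n) (λ c → shift (c *ℕ suc m) (gf (φ ∘ (replicate c (suc m) ++_)) m) n)
      ≈⟨ sumTo-first n _ ⟩
    gf φ m n + sumTo n (λ c → shift (suc m +ℕ c *ℕ suc m) (f c) n)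
      ≈⟨ +-congˡ (sumTo-cong n λ c → reflexive (shift-+ (suc m) (c *ℕ suc m) (f c) n)) ⟩
    gf φ m n + sumTo n (λ c → shift (suc m) (shift (c *ℕ suc m) (f c)) n)
      ≈⟨ +-congˡ (shift-sumTo (suc m) n _ n) ⟨
    gf φ m n + shift (suc m) (λ i → sumTo n (λ c → shift (c *ℕ suc m) (f c) i)) n
      ≈⟨ +-congˡ (shift-cong< (suc m) n truncate) ⟩
    gf φ m n + shift (suc m) (gf (φ ∘ (suc m ∷_)) (suc m)) n ∎
    where
    f : ℕ → PS
    f c = gf (φ ∘ (suc m ∷_) ∘ (replicate c (suc m) ++_)) m
    -- The outer sum leaves n terms where unfolding degree i gives i+1; the surplus multiplicities c
    -- > i need c(m+1) > i cells and contribute zero.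
    truncate : ∀ i → i +ℕ suc m ≤ n →
      sumTo n (λ c → shift (c *ℕ suc m) (f c) i) ≈ gf (φ ∘ (suc m ∷_)) (suc m) i
    truncate i i+m<n = begin
      sumTo n h                      ≡⟨ ≡.cong (λ k → sumTo k h) (ℕ.m∸n+n≡m i<n) ⟨
      sumTo (n ∸ suc i +ℕ suc i) h   ≈⟨ sumTo-extend (n ∸ suc i) (suc i) h (λ c i<c →
                                          shift-small (c *ℕ suc m) (f c) i (ℕ.<-≤-trans i<c (ℕ.m≤m*n c (suc m)))) ⟩
      sumTo (suc i) h                ≈⟨ gf-multiplicity (φ ∘ (suc m ∷_)) m i ⟨
      gf (φ ∘ (suc m ∷_)) (suc m) i ∎
      where
      h = λ c → shift (c *ℕ suc m) (f c) i
      i<n : suc i ≤ n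
      i<n = ℕ.≤-trans (≡.subst (suc i ≤_) (≡.sym (ℕ.+-suc i m)) (s≤s (ℕ.m≤m+n i m))) i+m<n

  gf-row : ∀ {φ ψ} r m → (∀ π → All (_≤ suc m) π → φ (suc m ∷ π) ≈ r * ψ π) →
           gf φ (suc m) ≋ (gf φ m ⊕ (mono r (suc m) ⊛ gf ψ (suc m)))
  gf-row {φ} {ψ} r m φ≈rψ n = begin
    gf φ (suc m) n
      ≈⟨ gf-suc φ m n ⟩
    gf φ m n + shift (suc m) (gf (φ ∘ (suc m ∷_)) (suc m)) n
      ≈⟨ +-congˡ (shift-cong (suc m) (λ i → trans (gf-cong (suc m) φ≈rψ i) (sumL-scale r ψ (parts (suc m) i))) n) ⟩
    gf φ m n + shift (suc m) (λ i → r * gf ψ (suc m) i) n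
      ≈⟨ +-congˡ (shift-* (suc m) n) ⟩
    gf φ m n + r * shift (suc m) (gf ψ (suc m)) n
      ≈⟨ +-congˡ (mono-⊛ r (suc m) (gf ψ (suc m)) n) ⟨
    gf φ m n + (mono r (suc m) ⊛ gf ψ (suc m)) n ∎
    where
    shift-* : ∀ d n → shift d (λ i → r * gf ψ (suc m) i) n ≈ r * shift d (gf ψ (suc m)) n
    shift-* zero n = refl
    shift-* (suc d) zero = sym (zeroʳ r)
    shift-* (suc d) (suc n) = shift-* d n

  -- A partition counted on the left but not on the right begins with one of the parts lo+1, ...,
  -- lo+d, on which φ vanishes.
  gf-skip : ∀ {φ} d lo → (∀ j π → j < d → φ (suc (j +ℕ lo) ∷ π) ≈ 0#) → gf φ (d +ℕ lo) ≋ gf φ lo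
  gf-skip zero lo φ≈0 n = refl
  gf-skip {φ} (suc d) lo φ≈0 n = begin
    gf φ (suc d +ℕ lo) n
      ≈⟨ gf-row {ψ = λ _ → 0#} 0# (d +ℕ lo) (λ π _ → trans (φ≈0 d π ℕ.≤-refl) (sym (zeroˡ 0#))) n ⟩
    gf φ (d +ℕ lo) n + (mono 0# (suc d +ℕ lo) ⊛ gf (λ _ → 0#) (suc d +ℕ lo)) n
      ≈⟨ +-cong (gf-skip d lo (λ j π j<d → φ≈0 j π (ℕ.m<n⇒m<1+n j<d)) n)
                (trans (mono-⊛ 0# (suc d +ℕ lo) (gf (λ _ → 0#) (suc d +ℕ lo)) n) (zeroˡ _)) ⟩
    gf φ lo n + 0#
      ≈⟨ +-identityʳ _ ⟩
    gf φ lo n ∎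

  gf-stable : ∀ φ d m n → n ≤ m → gf φ (d +ℕ m) n ≈ gf φ m n
  gf-stable φ zero m n n≤m = refl
  gf-stable φ (suc d) m n n≤m = begin
    gf φ (suc (d +ℕ m)) n  ≈⟨ gf-suc φ (d +ℕ m) n ⟩
    gf φ (d +ℕ m) n + shift (suc (d +ℕ m)) (gf (φ ∘ (suc (d +ℕ m) ∷_)) (suc (d +ℕ m))) n
      ≈⟨ +-cong (gf-stable φ d m n n≤m) (shift-small _ _ n (s≤s (ℕ.≤-trans n≤m (ℕ.m≤n+m m d)))) ⟩
    gf φ m n + 0#          ≈⟨ +-identityʳ _ ⟩
    gf φ m n ∎

  restrict : (List ℕ → Bool) → (List ℕ → Carrier) → List ℕ → Carrier
  restrict P μ π = if P π then μ π else 0#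

  restrict-* : ∀ P {μ ν} r π → μ π ≈ r * ν π → restrict P μ π ≈ r * restrict P ν π
  restrict-* P r π μ≈rν with P π
  ... | true = μ≈rν
  ... | false = sym (zeroʳ r)

  if-cong : ∀ {p q : Bool} u → p ≡ q → (if p then u else 0#) ≈ (if q then u else 0#)
  if-cong u p≡q = reflexive (≡.cong (if_then u else 0#) p≡q)

  gf-once : ∀ P {μ ν} r d lo →
    (∀ j π → j ≤ d → P (suc (d +ℕ lo) ∷ suc (j +ℕ lo) ∷ π) ≡ false) →
    (∀ π → All (_≤ lo) π → P (suc (d +ℕ lo) ∷ π) ≡ P π) →
    (∀ π → μ (suc (d +ℕ lo) ∷ π) ≈ r * ν π) →
    gf (restrict P μ) (suc d +ℕ lo)
      ≋ (gf (restrict P μ) (d +ℕ lo) ⊕ (mono r (suc d +ℕ lo) ⊛ gf (restrict P ν) lo))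
  gf-once P {μ} {ν} r d lo excluded allowed μ≈rν n = begin
    gf (restrict P μ) (suc d +ℕ lo) n
      ≈⟨ gf-row {ψ = restrict (P ∘ (p ∷_)) ν} r (d +ℕ lo)
           (λ π _ → restrict-* (P ∘ (p ∷_)) {μ ∘ (p ∷_)} {ν} r π (μ≈rν π)) n ⟩
    gf (restrict P μ) (d +ℕ lo) n + (mono r p ⊛ gf (restrict (P ∘ (p ∷_)) ν) p) n
      ≈⟨ +-congˡ (⊛-cong {f = mono r p} (λ _ → refl) (λ i → trans
           (gf-skip (suc d) lo (λ { j π (s≤s j≤d) → if-cong (ν (suc (j +ℕ lo) ∷ π)) (excluded j π j≤d) }) i)
           (gf-cong lo (λ π π≤lo → if-cong (ν π) (allowed π π≤lo)) i)) n) ⟩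
    gf (restrict P μ) (d +ℕ lo) n + (mono r p ⊛ gf (restrict P ν) lo) n ∎
    where p = suc (d +ℕ lo)

-- How the three classes react to a new largest part.

module PartPredicates (k : ℕ) ⦃ nz : NonZero k ⦄ where
  open Classes k
  open ≡ using (refl; sym; trans; cong; cong₂; subst; module ≡-Reasoning)

  ≡ᵇ-refl : ∀ n → (n ≡ᵇ n) ≡ true
  ≡ᵇ-refl n = Equivalence.to T-≡ (ℕ.≡⇒≡ᵇ n n refl)

  ≢⇒≡ᵇ-false : ∀ m n → ¬ m ≡ n → (m ≡ᵇ n) ≡ false
  ≢⇒≡ᵇ-false m n m≢n = ¬-not λ m≡ᵇn → m≢n (ℕ.≡ᵇ⇒≡ m n (Equivalence.from T-≡ m≡ᵇn))

  block-% : ∀ r M → r < k → (r +ℕ M *ℕ k) % k ≡ r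
  block-% r M r<k = trans ([m+kn]%n≡m%n r M k) (m<n⇒m%n≡m r<k)

  block-/ : ∀ r M → r < k → (r +ℕ M *ℕ k) / k ≡ M
  block-/ r M r<k = trans (+-distrib-/-∣ʳ r (n∣m*n M)) (cong₂ _+ℕ_ (m<n⇒m/n≡0 r<k) (m*n/n≡m M k))

  anyL-false : ∀ {f} {Q : ℕ → Set} → (∀ q → Q q → f q ≡ false) → ∀ {π} → All Q π → anyL f π ≡ false
  anyL-false f≡false [] = refl
  anyL-false f≡false (q ∷ qs) = cong₂ _∨_ (f≡false _ q) (anyL-false f≡false qs)

  allL-cong : ∀ {f g} → (∀ q → f q ≡ g q) → ∀ π → allL f π ≡ allL g π
  allL-cong f≡g [] = refl
  allL-cong f≡g (q ∷ π) = cong₂ _∧_ (f≡g q) (allL-cong f≡g π)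

  sameBlock-in : ∀ r j M → suc r < k → suc j < k →
                 sameBlock (suc r +ℕ M *ℕ k) (suc j +ℕ M *ℕ k) ≡ true
  sameBlock-in r j M r<k j<k
    rewrite block-% (suc r) M r<k | block-% (suc j) M j<k | block-/ (suc r) M r<k | block-/ (suc j) M j<k
    = ≡ᵇ-refl M

  -- A q in the block would be Mk plus a positive remainder, which exceeds the bound Mk.
  sameBlock-below : ∀ r M → r < k → ∀ q → q ≤ M *ℕ k → sameBlock (r +ℕ M *ℕ k) q ≡ false
  sameBlock-below r M r<k q q≤Mk with inBlock (r +ℕ M *ℕ k)
  ... | false = refl
  ... | true with q % k in rem
  ...   | zero = refl
  ...   | suc s rewrite block-/ r M r<k = ≢⇒≡ᵇ-false M (q / k) λ M≡ →
          ℕ.<⇒≱ (ℕ.m<n+m (M *ℕ k) (s≤s {0} {s} z≤n))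
            (subst (_≤ M *ℕ k) (trans (m≡m%n+[m/n]*n q k) (cong₂ (λ i j → i +ℕ j *ℕ k) rem (sym M≡))) q≤Mk)

  sameBlock-multiple : ∀ M q → sameBlock (M *ℕ k) q ≡ false
  sameBlock-multiple M q rewrite m*n%n≡0 M k ⦃ nz ⦄ = refl

  isS-excluded : ∀ r j M π → suc r < k → suc j < k →
                 isS (suc r +ℕ M *ℕ k ∷ suc j +ℕ M *ℕ k ∷ π) ≡ false
  isS-excluded r j M π r<k j<k rewrite sameBlock-in r j M r<k j<k = refl

  isS-allowed : ∀ r M π → r < k → All (_≤ M *ℕ k) π → isS (r +ℕ M *ℕ k ∷ π) ≡ isS π
  isS-allowed r M π r<k π≤ rewrite anyL-false (sameBlock-below r M r<k) π≤ = refl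

  isS-multiple : ∀ M π → isS (M *ℕ k ∷ π) ≡ isS π
  isS-multiple M π
    rewrite anyL-false {f = sameBlock (M *ℕ k)} (λ q _ → sameBlock-multiple M q) (All.universal {P = 0 ≤_} (λ _ → z≤n) π)
    = refl

  distinct-allowed : ∀ m p π → m < p → All (_≤ m) π → distinct (p ∷ π) ≡ distinct π
  distinct-allowed m p π m<p π≤
    rewrite anyL-false {f = p ≡ᵇ_} (λ q q≤m → ≢⇒≡ᵇ-false p q (ℕ.>⇒≢ (ℕ.≤-<-trans q≤m m<p))) π≤ = refl

  distinct-excluded : ∀ p π → distinct (p ∷ p ∷ π) ≡ false
  distinct-excluded p π rewrite ≡ᵇ-refl p = refl

  count-above : ∀ m p π → m < p → All (_≤ m) π → count p π ≡ 0
  count-above m p [] m<p [] = refl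
  count-above m p (q ∷ π) m<p (q≤m ∷ π≤)
    rewrite ≢⇒≡ᵇ-false p q (ℕ.>⇒≢ (ℕ.≤-<-trans q≤m m<p)) = count-above m p π m<p π≤

  goodPart : List ℕ → ℕ → Bool
  goodPart π p = (p % k ≡ᵇ 0) ∧ (count p π % 2 ≡ᵇ 0)

  isE-offMultiple : ∀ r M π → suc r < k → isE (suc r +ℕ M *ℕ k ∷ π) ≡ false
  isE-offMultiple r M π r<k rewrite block-% (suc r) M r<k = refl

  -- The head occurs exactly once, an odd number of times.
  isE-single : ∀ m p π → m < p → All (_≤ m) π → isE (p ∷ π) ≡ false
  isE-single m p π m<p π≤ rewrite ≡ᵇ-refl p | count-above m p π m<p π≤ | ∧-zeroʳ (p % k ≡ᵇ 0) = refl

  goodPart-double : ∀ p π q → goodPart (p ∷ p ∷ π) q ≡ goodPart π q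
  goodPart-double p π q with q ≡ᵇ p
  ... | true = cong (λ c → (q % k ≡ᵇ 0) ∧ (c ≡ᵇ 0))
    (trans (cong (_% 2) (ℕ.+-comm 2 (count q π))) ([m+kn]%n≡m%n (count q π) 1 2))
  ... | false = refl

  count-all : ∀ f p π → allL f π ≡ true → count p π ≡ 0 ⊎ f p ≡ true
  count-all f p [] all = inj₁ refl
  count-all f p (q ∷ π) all with f q in fq | p ≡ᵇ q in p≡q
  ... | true | true rewrite ℕ.≡ᵇ⇒≡ p q (Equivalence.from T-≡ p≡q) = inj₂ fq
  ... | true | false = count-all f p π all

  -- Two further copies change no parity, so only the condition on p = Mk is new. If p occurs in π,
  -- then `isE π` already contains it; otherwise its count 0 is even and p is a multiple of k.
  isE-double : ∀ M π → isE (M *ℕ k ∷ M *ℕ k ∷ π) ≡ isE π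
  isE-double M π = begin
    isE (p ∷ p ∷ π)                            ≡⟨ allL-cong (goodPart-double p π) (p ∷ p ∷ π) ⟩
    goodPart π p ∧ goodPart π p ∧ isE π        ≡⟨ absorb (isE π) refl ⟩
    isE π ∎
    where
    open ≡-Reasoning
    p = M *ℕ k
    good : allL (goodPart π) π ≡ true → goodPart π p ≡ true
    good all with count-all (goodPart π) p π all
    ... | inj₂ g = g
    ... | inj₁ c≡0 rewrite c≡0 | m*n%n≡0 M k ⦃ nz ⦄ = refl
    absorb : ∀ e → isE π ≡ e → goodPart π p ∧ goodPart π p ∧ e ≡ e
    absorb true all rewrite good all = refl
    absorb false _ = trans (cong (goodPart π p ∧_) (∧-zeroʳ _)) (∧-zeroʳ _)

  isDS-excluded : ∀ r j M π → suc r < k → suc j < k →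
                  isDS (suc r +ℕ M *ℕ k ∷ suc j +ℕ M *ℕ k ∷ π) ≡ false
  isDS-excluded r j M π r<k j<k =
    cong (_∧ distinct (suc r +ℕ M *ℕ k ∷ suc j +ℕ M *ℕ k ∷ π)) (isS-excluded r j M π r<k j<k)

  isDS-allowed : ∀ r M π → suc r < k → All (_≤ M *ℕ k) π → isDS (suc r +ℕ M *ℕ k ∷ π) ≡ isDS π
  isDS-allowed r M π r<k π≤ = cong₂ _∧_ (isS-allowed (suc r) M π r<k π≤)
    (distinct-allowed (M *ℕ k) _ π (s≤s (ℕ.m≤n+m (M *ℕ k) r)) π≤)

  isDS-multiple-excluded : ∀ p π → isDS (p ∷ p ∷ π) ≡ false
  isDS-multiple-excluded p π = trans (cong (isS (p ∷ p ∷ π) ∧_) (distinct-excluded p π)) (∧-zeroʳ _)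

  isDS-multiple-allowed : ∀ m M π → m < M *ℕ k → All (_≤ m) π → isDS (M *ℕ k ∷ π) ≡ isDS π
  isDS-multiple-allowed m M π m<p π≤ = cong₂ _∧_ (isS-multiple M π) (distinct-allowed m (M *ℕ k) π m<p π≤)

-- Row weights and the block recurrences modulo t^N.

mod-periodic : ∀ i M k → (i +ℕ M *ℕ suc k) mod suc k ≡ i mod suc k
mod-periodic i M k = Fin.fromℕ<-cong _ _ ([m+kn]%n≡m%n i M (suc k)) _ _

module Truncated {c ℓ : Level} (R : CommutativeRing c ℓ) (k′ : ℕ) (N : ℕ) where
  open Series R
  open PowerSeries R
  open PartitionSums R
  private module R = CommutativeRing R
  open R using (Carrier)
  private module T = CommutativeRing (truncatedRing N)
  private module ST = Series (truncatedRing N)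
  open Recurrence (truncatedRing N)
  open Classes (suc k′)
  open PartPredicates (suc k′)
  open import Relation.Binary.Reasoning.Setoid T.setoid

  k : ℕ
  k = suc k′

  _≈N_ : PS → PS → Set ℓ
  _≈N_ = _≋<_ N

  ≋⇒≈N : ∀ {f g} → f ≋ g → f ≈N g
  ≋⇒≈N f≋g i _ = f≋g i

  prodS≡ : ∀ n F → prodS n F ≡ ST.prodTo n F
  prodS≡ zero F = ≡.refl
  prodS≡ (suc n) F = ≡.cong (_⊛ F n) (prodS≡ n F)

  powS≈ : ∀ u n → powS u n ≈N pow u n
  powS≈ u n = T.reflexive (prodS≡ n (λ _ → u))

  prodTo-cong : ∀ n {F H} → (∀ i → F i ≈N H i) → ST.prodTo n F ≈N ST.prodTo n H
  prodTo-cong zero F≈H = T.refl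
  prodTo-cong (suc n) {F} {H} F≈H = T.*-cong {ST.prodTo n F} {ST.prodTo n H} {F n} {H n} (prodTo-cong n F≈H) (F≈H n)

  module Rows (l : Fin k → Carrier) where

    rowWeight : ℕ → Carrier
    rowWeight n = prodTo n (λ j → l (j mod k))

    cell : ℕ → PS
    cell i = mono (l (i mod k)) 1

    -- For the labels a_i these are z_k and x_k; for the b_i they are z′ and x′.
    full partialRows : PS
    full = prodS k cell
    partialRows = sumS k′ (λ j → prodS (suc j) cell)

    row-mono : ∀ n → mono (rowWeight n) n ≈N prodS n cell
    row-mono zero = T.refl
    row-mono (suc n) = begin
      mono (rowWeight (suc n)) (suc n)         ≡⟨ ≡.cong (mono (rowWeight (suc n))) (ℕ.+-comm 1 n) ⟩
      mono (rowWeight (suc n)) (n +ℕ 1)        ≈⟨ ≋⇒≈N (mono-mono (rowWeight n) n (l (n mod k)) 1) ⟨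
      mono (rowWeight n) n ⊛ cell n            ≈⟨ T.*-congʳ {cell n} (row-mono n) ⟩
      prodS n cell ⊛ cell n ∎

    row-split : ∀ M j → prodS (j +ℕ M *ℕ k) cell ≈N (pow full M ⊛ prodS j cell)
    row-split zero zero = T.sym {oneS ⊛ oneS} {oneS} (T.*-identityˡ oneS)
    -- A row of (M+1)k cells is read as k cells following Mk cells, which lowers M while j restarts
    -- at k.
    row-split (suc M) zero = begin
      prodS (k +ℕ M *ℕ k) cell   ≈⟨ row-split M k ⟩
      pow full M ⊛ full          ≈⟨ T.*-identityʳ (pow full (suc M)) ⟨
      pow full (suc M) ⊛ oneS ∎
    row-split M (suc j) = begin
      prodS (j +ℕ M *ℕ k) cell ⊛ cell (j +ℕ M *ℕ k)
        ≡⟨ ≡.cong (λ i → prodS (j +ℕ M *ℕ k) cell ⊛ mono (l i) 1) (mod-periodic j M k′) ⟩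
      prodS (j +ℕ M *ℕ k) cell ⊛ cell j     ≈⟨ T.*-congʳ {cell j} (row-split M j) ⟩
      (pow full M ⊛ prodS j cell) ⊛ cell j  ≈⟨ T.*-assoc (pow full M) (prodS j cell) (cell j) ⟩
      pow full M ⊛ prodS (suc j) cell ∎

    row-block : ∀ M j → mono (rowWeight (j +ℕ M *ℕ k)) (j +ℕ M *ℕ k) ≈N (pow full M ⊛ prodS j cell)
    row-block M j = T.trans (row-mono (j +ℕ M *ℕ k)) (row-split M j)

    row-full : ∀ M → mono (rowWeight (suc M *ℕ k)) (suc M *ℕ k) ≈N pow full (suc M)
    row-full M = row-block M k

    -- The power is a monomial of degree Nk, and Nk is at least N.
    full-nilpotent : pow full N ≈N mono R.0# 0
    full-nilpotent = begin
      pow full N                             ≈⟨ T.*-identityʳ (pow full N) ⟨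
      pow full N ⊛ oneS                      ≈⟨ row-block N 0 ⟨
      mono (rowWeight (N *ℕ k)) (N *ℕ k)     ≈⟨ (λ i i<N → R.trans (mono-small (N *ℕ k) i (ℕ.<-≤-trans i<N (ℕ.m≤m*n N k)))
                                                                (R.sym (mono-0# 0 i))) ⟩
      mono R.0# 0 ∎
      where
      mono-small : ∀ d i → i < d → mono (rowWeight (N *ℕ k)) d i R.≈ R.0#
      mono-small (suc d) zero _ = R.refl
      mono-small (suc d) (suc i) (s≤s i<d) = mono-small d i i<d

    -- μ labels the top row by l and leaves the other rows to ν. The pair `ωodd`, `ωeven` in either
    -- order gives D_M and D′_M.
    module Weights (μ ν : List ℕ → Carrier) (μ-row : ∀ p π → μ (p ∷ π) R.≈ rowWeight p R.* ν π) where

      level : (List ℕ → Bool) → (List ℕ → Carrier) → ℕ → PS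
      level P φ M = gf (restrict P φ) (M *ℕ k)

      block-sum : ∀ P M →
        (∀ r j π → suc r < k → j ≤ r → P (suc r +ℕ M *ℕ k ∷ suc j +ℕ M *ℕ k ∷ π) ≡ false) →
        (∀ r π → suc r < k → All (_≤ M *ℕ k) π → P (suc r +ℕ M *ℕ k ∷ π) ≡ P π) →
        ∀ r → r < k → gf (restrict P μ) (r +ℕ M *ℕ k)
          ≈N (level P μ M ⊕ ((pow full M ⊛ sumS r (λ j → prodS (suc j) cell)) ⊛ level P ν M))
      block-sum P M excluded allowed zero _ = begin
        L                                 ≈⟨ T.+-identityʳ L ⟨
        L ⊕ mono R.0# 0                   ≈⟨ T.+-congˡ {L} (T.zeroˡ L′) ⟨
        L ⊕ (mono R.0# 0 ⊛ L′)            ≈⟨ T.+-congˡ {L} (T.*-congʳ {L′} (T.zeroʳ (pow full M))) ⟨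
        L ⊕ ((pow full M ⊛ mono R.0# 0) ⊛ L′) ∎
        where L = level P μ M ; L′ = level P ν M
      block-sum P M excluded allowed (suc r) r<k = begin
        gf (restrict P μ) (suc r +ℕ M *ℕ k)
          ≈⟨ ≋⇒≈N (gf-once P {μ} {ν} (rowWeight p) r (M *ℕ k) (λ j π → excluded r j π r<k)
                     (λ π → allowed r π r<k) (μ-row p)) ⟩
        gf (restrict P μ) (r +ℕ M *ℕ k) ⊕ (mono (rowWeight p) p ⊛ L′)
          ≈⟨ T.+-cong {gf (restrict P μ) (r +ℕ M *ℕ k)} {L ⊕ ((Z ⊛ X) ⊛ L′)}
               (block-sum P M excluded allowed r (ℕ.<-trans ℕ.≤-refl r<k)) (T.*-congʳ {L′} (row-block M (suc r))) ⟩
        (L ⊕ ((Z ⊛ X) ⊛ L′)) ⊕ ((Z ⊛ Y) ⊛ L′)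
          ≈⟨ T.+-assoc L ((Z ⊛ X) ⊛ L′) ((Z ⊛ Y) ⊛ L′) ⟩
        L ⊕ (((Z ⊛ X) ⊛ L′) ⊕ ((Z ⊛ Y) ⊛ L′))
          ≈⟨ T.+-congˡ {L} (T.distribʳ L′ (Z ⊛ X) (Z ⊛ Y)) ⟨
        L ⊕ (((Z ⊛ X) ⊕ (Z ⊛ Y)) ⊛ L′)
          ≈⟨ T.+-congˡ {L} (T.*-congʳ {L′} (T.distribˡ Z X Y)) ⟨
        L ⊕ ((Z ⊛ (X ⊕ Y)) ⊛ L′) ∎
        where
        L = level P μ M ; L′ = level P ν M
        Z = pow full M
        X = sumS r (λ j → prodS (suc j) cell)
        Y = prodS (suc r) cell
        p = suc r +ℕ M *ℕ k


      isS-step : ImplicitStep partialRows full (level isS μ) (level isS ν)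
      isS-step M = begin
        gf (restrict isS μ) p
          ≈⟨ ≋⇒≈N (gf-row {ψ = restrict isS ν} (rowWeight p) (k′ +ℕ M *ℕ k) λ π _ →
               R.trans (if-cong (μ (p ∷ π)) (isS-multiple (suc M) π))
                       (restrict-* isS {μ ∘ (p ∷_)} {ν} (rowWeight p) π (μ-row p π))) ⟩
        gf (restrict isS μ) (k′ +ℕ M *ℕ k) ⊕ (mono (rowWeight p) p ⊛ level isS ν (suc M))
          ≈⟨ T.+-cong {gf (restrict isS μ) (k′ +ℕ M *ℕ k)}
               {level isS μ M ⊕ ((pow full M ⊛ partialRows) ⊛ level isS ν M)}
               (block-sum isS M (λ r j π r<k j≤r → isS-excluded r j M π r<k (ℕ.≤-<-trans (s≤s j≤r) r<k))
                                (λ r π r<k → isS-allowed (suc r) M π r<k) k′ ℕ.≤-refl)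
               (T.*-congʳ {level isS ν (suc M)} (row-full M)) ⟩
        (level isS μ M ⊕ ((pow full M ⊛ partialRows) ⊛ level isS ν M))
          ⊕ (pow full (suc M) ⊛ level isS ν (suc M)) ∎
        where p = suc M *ℕ k

      isDS-block : ∀ M → gf (restrict isDS μ) (k′ +ℕ M *ℕ k)
        ≈N (level isDS μ M ⊕ ((pow full M ⊛ partialRows) ⊛ level isDS ν M))
      isDS-block M = block-sum isDS M
        (λ r j π r<k j≤r → isDS-excluded r j M π r<k (ℕ.≤-<-trans (s≤s j≤r) r<k))
        (λ r π r<k → isDS-allowed r M π r<k) k′ ℕ.≤-refl

      -- Distinctness forbids only a second (M+1)k, so below it the whole block stays available and
      -- `isDS-block` is needed for both weights.
      isDS-top : ∀ M → level isDS μ (suc M)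
        ≈N (gf (restrict isDS μ) (k′ +ℕ M *ℕ k) ⊕ (pow full (suc M) ⊛ gf (restrict isDS ν) (k′ +ℕ M *ℕ k)))
      isDS-top M = begin
        gf (restrict isDS μ) p
          ≈⟨ ≋⇒≈N (gf-once isDS {μ} {ν} (rowWeight p) 0 m (λ { j π z≤n → isDS-multiple-excluded p π })
                     (λ π → isDS-multiple-allowed m (suc M) π ℕ.≤-refl) (μ-row p)) ⟩
        gf (restrict isDS μ) m ⊕ (mono (rowWeight p) p ⊛ gf (restrict isDS ν) m)
          ≈⟨ T.+-congˡ {gf (restrict isDS μ) m} (T.*-congʳ {gf (restrict isDS ν) m} (row-full M)) ⟩
        gf (restrict isDS μ) m ⊕ (pow full (suc M) ⊛ gf (restrict isDS ν) m) ∎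
        where p = suc M *ℕ k ; m = k′ +ℕ M *ℕ k

      level-zero : ∀ P → P [] ≡ true → μ [] R.≈ R.1# → level P μ 0 ≈N oneS
      level-zero P P[] μ[] zero _ = R.trans (R.+-identityʳ _) (R.trans (if-cong (μ []) P[]) μ[])
      level-zero P P[] μ[] (suc i) _ = R.refl

  module Alternating (l l′ : Fin k → Carrier) (μ ν : List ℕ → Carrier)
                     (μ-row : ∀ p π → μ (p ∷ π) R.≈ Rows.rowWeight l p R.* ν π)
                     (ν-row : ∀ p π → ν (p ∷ π) R.≈ Rows.rowWeight l′ p R.* μ π) where
    private
      module L = Rows l
      module L′ = Rows l′
      module μ = L.Weights μ ν μ-row
      module ν = L′.Weights ν μ ν-row

    isDS-step : CoupledStep L.partialRows L′.partialRows L.full L′.full (μ.level isDS μ) (μ.level isDS ν)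
    isDS-step M = T.trans (μ.isDS-top M) (T.+-cong {gf (restrict isDS μ) (k′ +ℕ M *ℕ k)}
      {μ.level isDS μ M ⊕ ((pow L.full M ⊛ L.partialRows) ⊛ μ.level isDS ν M)} (μ.isDS-block M)
      (T.*-congˡ {pow L.full (suc M)} (ν.isDS-block M)))

    -- The top part p = (M+1)k must be followed by another p, by `isE-single`, and removing both
    -- leaves a member of ℰ^k by `isE-double`. The two rows carry different labels, whence the
    -- product of the two full powers.
    isE-step : ∀ M → μ.level isE μ (suc M)
      ≈N (μ.level isE μ M ⊕ ((pow L.full (suc M) ⊛ pow L′.full (suc M)) ⊛ μ.level isE μ (suc M)))
    isE-step M = begin
      gf φ p
        ≈⟨ ≋⇒≈N (gf-row {φ} {ψ} (L.rowWeight p) m (λ π _ →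
             restrict-* (isE ∘ (p ∷_)) {μ ∘ (p ∷_)} {ν} (L.rowWeight p) π (μ-row p π))) ⟩
      gf φ m ⊕ (mono (L.rowWeight p) p ⊛ gf ψ p)
        ≈⟨ T.+-cong {gf φ m} {gf φ (M *ℕ k)}
             (≋⇒≈N (gf-skip k′ (M *ℕ k) λ j π j<k′ →
               if-cong (μ (suc j +ℕ M *ℕ k ∷ π)) (isE-offMultiple j M π (s≤s j<k′))))
             (T.*-cong {mono (L.rowWeight p) p} {pow L.full (suc M)} {gf ψ p} (L.row-full M) ψ-step) ⟩
      gf φ (M *ℕ k) ⊕ (pow L.full (suc M) ⊛ (pow L′.full (suc M) ⊛ gf φ p))
        ≈⟨ T.+-congˡ {gf φ (M *ℕ k)} (T.*-assoc (pow L.full (suc M)) (pow L′.full (suc M)) (gf φ p)) ⟨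
      gf φ (M *ℕ k) ⊕ ((pow L.full (suc M) ⊛ pow L′.full (suc M)) ⊛ gf φ p) ∎
      where
      p = suc M *ℕ k ; m = k′ +ℕ M *ℕ k
      φ = restrict isE μ ; ψ = restrict (isE ∘ (p ∷_)) ν
      ψ-step : gf ψ p ≈N (pow L′.full (suc M) ⊛ gf φ p)
      ψ-step = begin
        gf ψ p
          ≈⟨ ≋⇒≈N (gf-row {ψ} {φ} (L′.rowWeight p) m (λ π _ →
               R.trans (if-cong (ν (p ∷ π)) (isE-double (suc M) π))
                       (restrict-* isE {ν ∘ (p ∷_)} {μ} (L′.rowWeight p) π (ν-row p π)))) ⟩
        gf ψ m ⊕ (mono (L′.rowWeight p) p ⊛ gf φ p)
          ≈⟨ T.+-cong {gf ψ m} {mono R.0# 0} (λ i _ → R.trans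
               (R.trans (gf-cong m (λ π π≤m → if-cong (ν π) (isE-single m p π ℕ.≤-refl π≤m)) i) (sumL-zero (parts m i)))
               (R.sym (mono-0# 0 i))) (T.*-congʳ {gf φ p} (L′.row-full M)) ⟩
        mono R.0# 0 ⊕ (pow L′.full (suc M) ⊛ gf φ p)
          ≈⟨ T.+-identityˡ (pow L′.full (suc M) ⊛ gf φ p) ⟩
        pow L′.full (suc M) ⊛ gf φ p ∎

  -- The three product formulas modulo t^N.

  module Products (a b : Fin k → Carrier) where
    open Thm R k a b
    private
      module L = Rows a
      module L′ = Rows b
      module O = L.Weights ωodd ωeven (λ _ _ → R.refl)
      module E = L′.Weights ωeven ωodd (λ _ _ → R.refl)
      module OE = Alternating a b ωodd ωeven (λ _ _ → R.refl) (λ _ _ → R.refl)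
      module EO = Alternating b a ωeven ωodd (λ _ _ → R.refl) (λ _ _ → R.refl)

    w≈zz′ : w ≈N (z ⊛ prodS k tb)
    w≈zz′ = go k
      where
      open import Algebra.Properties.CommutativeSemigroup T.*-commutativeSemigroup using (interchange)
      go : ∀ n → prodS n (λ i → ta i ⊛ tb i) ≈N (prodS n ta ⊛ prodS n tb)
      go zero = T.sym {oneS ⊛ oneS} {oneS} (T.*-identityˡ oneS)
      go (suc n) = T.trans (T.*-congʳ {ta n ⊛ tb n} (go n)) (interchange (prodS n ta) (prodS n tb) (ta n) (tb n))

    open Clearing z L′.full w w≈zz′ using (cleared; cleared-step; cleared-constant)

    z-nilpotent : pow z N ≈N mono R.0# 0
    z-nilpotent = L.full-nilpotent

    w-nilpotent : pow w N ≈N mono R.0# 0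
    w-nilpotent = begin
      pow w N                        ≈⟨ pow-cong w≈zz′ N ⟩
      pow (z ⊛ L′.full) N            ≈⟨ pow-* z L′.full N ⟩
      pow z N ⊛ pow L′.full N        ≈⟨ T.*-congʳ {pow L′.full N} z-nilpotent ⟩
      mono R.0# 0 ⊛ pow L′.full N    ≈⟨ T.zeroˡ (pow L′.full N) ⟩
      mono R.0# 0 ∎

    -- In degree i < N all parts are at most i, hence at most Nk, so the bound on the parts excludes
    -- nothing.
    genSeries≈level : ∀ P → genSeries P ≈N O.level P ωodd N
    genSeries≈level P i i<N = R.trans (R.reflexive (sumIf≡ (parts i i)))
      (R.trans (R.sym (gf-stable (restrict P ωodd) (N *ℕ k ∸ i) i i ℕ.≤-refl))
               (R.reflexive (≡.cong (λ m → gf (restrict P ωodd) m i)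
                 (ℕ.m∸n+n≡m (ℕ.≤-trans (ℕ.<⇒≤ i<N) (ℕ.m≤m*n N k))))))
      where
      sumIf≡ : ∀ πs → sumIf P πs ≡ sumL (restrict P ωodd) πs
      sumIf≡ [] = ≡.refl
      sumIf≡ (π ∷ πs) = ≡.cong (restrict P ωodd π R.+_) (sumIf≡ πs)

    isDS-product : (ST.prodTo N (factor w z) ⊛ O.level isDS ωodd N)
      ≈N (ST.prodTo N (factor w (⊖ x)) ⊛ ST.prodTo N (factor w (⊖ y)))
    isDS-product = Coupled.limit x L′.partialRows z L′.full w w≈zz′ (O.level isDS ωodd) (O.level isDS ωeven)
      (O.level-zero isDS ≡.refl R.refl) (E.level-zero isDS ≡.refl R.refl) OE.isDS-step EO.isDS-step N z-nilpotent

    isS-product : ((ST.prodTo N (factor w z) ⊛ ST.prodTo N (factor w w)) ⊛ O.level isS ωodd N)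
      ≈N (ST.prodTo N (factor w (⊖ x)) ⊛ ST.prodTo N (factor w (⊖ y)))
    isS-product = begin
      (Pz ⊛ Pw) ⊛ O.level isS ωodd N    ≈⟨ T.*-assoc Pz Pw (O.level isS ωodd N) ⟩
      Pz ⊛ (Pw ⊛ O.level isS ωodd N)    ≈⟨ T.*-congˡ {Pz} (T.*-comm Pw (O.level isS ωodd N)) ⟩
      Pz ⊛ cleared (O.level isS ωodd) N
        ≈⟨ Coupled.limit x L′.partialRows z L′.full w w≈zz′ (cleared (O.level isS ωodd)) (cleared (O.level isS ωeven))
             (T.trans (T.*-identityʳ (O.level isS ωodd 0)) (O.level-zero isS ≡.refl R.refl))
             (T.trans (T.*-identityʳ (O.level isS ωeven 0)) (E.level-zero isS ≡.refl R.refl))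
             (cleared-step {x} {L′.partialRows} O.isS-step E.isS-step)
             (cleared-step′ {L′.partialRows} {x} E.isS-step O.isS-step) N z-nilpotent ⟩
      ST.prodTo N (factor w (⊖ x)) ⊛ ST.prodTo N (factor w (⊖ y)) ∎
      where
      Pz = ST.prodTo N (factor w z) ; Pw = ST.prodTo N (factor w w)
      -- The body of `cleared` involves only w, so exchanging z and z′ yields the mirror-image step
      -- for the same cleared sequences.
      open Clearing L′.full z w (T.trans w≈zz′ (T.*-comm z L′.full)) using () renaming (cleared-step to cleared-step′)

    isE-product : (ST.prodTo N (factor w w) ⊛ O.level isE ωodd N) ≈N oneS
    isE-product = T.trans (T.*-comm (ST.prodTo N (factor w w)) (O.level isE ωodd N))
      (cleared-constant (O.level-zero isE ≡.refl R.refl) OE.isE-step N)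

    prodS-factors : ∀ n u → prodS n (λ j → oneS ⊕ (⊖ (u ⊛ powS w j))) ≈N ST.prodTo n (factor w u)
    prodS-factors n u = T.trans (T.reflexive (prodS≡ n _)) (prodTo-cong n λ j →
      T.+-congˡ {oneS} (T.-‿cong (T.*-congˡ {u} (powS≈ w j))))

-- From truncations to identities of power series.

module Assembly {c ℓ : Level} (R : CommutativeRing c ℓ) (k′ : ℕ)
                (a b : Fin (suc k′) → CommutativeRing.Carrier R) where
  open CommutativeRing R
  open Series R
  open PowerSeries R
  open Thm R (suc k′) a b
  open Classes (suc k′)
  private module At N = Truncated.Products R k′ N a b

  powS-nilpotent : ∀ u N → _≋<_ N (Recurrence.pow (truncatedRing N) u N) (mono 0# 0) →
                   ∀ i → i < N → powS u N i ≈ 0#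
  powS-nilpotent u N u^N≈0 i i<N =
    trans (Truncated.powS≈ R k′ N u N i i<N) (trans (u^N≈0 i i<N) (mono-0# 0 i))

  -- The coefficient of t^i in `poch` uses i+1 factors, the truncated product N. Modulo t^{i+1} the
  -- powers w^j with j > i vanish, so the additional factors are 1.
  poch-truncated : ∀ u N → _≋<_ N (poch u w)
    (Series.prodTo (truncatedRing N) N (Recurrence.factor (truncatedRing N) w u))
  poch-truncated u N i i<N = trans (sym (extend i ℕ.≤-refl)) (At.prodS-factors N N u i i<N)
    where
    F : ℕ → PS
    F j = oneS ⊕ (⊖ (u ⊛ powS w j))
    module T = CommutativeRing (truncatedRing (suc i))
    extend : _≋<_ (suc i) (prodS N F) (prodS (suc i) F)
    extend = T.trans
      (T.reflexive (≡.cong (λ n → prodS n F) (≡.sym (ℕ.m∸n+n≡m i<N))))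
      (T.trans (At.prodS-factors (suc i) (N ∸ suc i +ℕ suc i) u)
      (T.trans (Recurrence.prodTo-extend (truncatedRing (suc i)) w u (N ∸ suc i) (suc i) λ j i<j i′ i′≤i →
                 trans (sym (Truncated.powS≈ R k′ (suc i) w j i′ i′≤i))
                       (trans (powS-nilpotent w j (At.w-nilpotent j) i′ (ℕ.<-≤-trans i′≤i i<j)) (sym (mono-0# 0 i′))))
               (T.sym {prodS (suc i) F} (At.prodS-factors (suc i) (suc i) u))))

  ≋-truncations : ∀ {f g} → (∀ N → _≋<_ N f g) → f ≋ g
  ≋-truncations f≈g n = f≈g (suc n) n ℕ.≤-refl

  poch-const : ∀ u → u 0 ≈ 0# → poch u w 0 ≈ 1#
  poch-const u u₀≈0 = trans (⊛-identityˡ (oneS ⊕ (⊖ (u ⊛ oneS))) 0)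
    (trans (+-congˡ (trans (-‿cong (trans (⊛-zero u oneS) (trans (*-congʳ u₀≈0) (zeroˡ _)))) -0#≈0#)) (+-identityʳ 1#))
    where open import Algebra.Properties.Ring ring using (-0#≈0#)

  const-zero : ∀ u → powS u 1 0 ≈ 0# → u 0 ≈ 0#
  const-zero u u^1≈0 = trans (sym (⊛-identityˡ u 0)) u^1≈0

  poch-z-const : poch z w 0 ≈ 1#
  -- Nilpotency at N = 1 says that the constant term of z is zero.
  poch-z-const = poch-const z (const-zero z (powS-nilpotent z 1 (At.z-nilpotent 1) 0 ℕ.≤-refl))

  poch-w-const : poch w w 0 ≈ 1#
  poch-w-const = poch-const w (const-zero w (powS-nilpotent w 1 (At.w-nilpotent 1) 0 ℕ.≤-refl))

  E-identity : genSeries isE ≋ inv (poch w w)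
  E-identity n = trans
    (inv-unique (poch w w) (genSeries isE) oneS poch-w-const (≋-truncations λ N i i<N → trans
      (⊛-cong< N (poch-truncated w N) (At.genSeries≈level N isE) i i<N) (At.isE-product N i i<N)) n)
    (⊛-identityˡ (inv (poch w w)) n)

  numerator : ∀ N → _≋<_ N (Series.prodTo (truncatedRing N) N (Recurrence.factor (truncatedRing N) w (⊖ x))
                              ⊛ Series.prodTo (truncatedRing N) N (Recurrence.factor (truncatedRing N) w (⊖ y)))
                           (poch (⊖ x) w ⊛ poch (⊖ y) w)
  numerator N = ⊛-cong< N (λ i i<N → sym (poch-truncated (⊖ x) N i i<N)) (λ i i<N → sym (poch-truncated (⊖ y) N i i<N))

  S-identity : genSeries isS ≋ ((poch (⊖ x) w ⊛ poch (⊖ y) w) ⊛ inv (poch z w ⊛ poch w w))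
  S-identity = inv-unique (poch z w ⊛ poch w w) (genSeries isS) _
    (trans (⊛-zero (poch z w) (poch w w)) (trans (*-cong poch-z-const poch-w-const) (*-identityˡ 1#)))
    (≋-truncations λ N i i<N → trans
      (⊛-cong< N (⊛-cong< N (poch-truncated z N) (poch-truncated w N)) (At.genSeries≈level N isS) i i<N)
      (trans (At.isS-product N i i<N) (numerator N i i<N)))

  DS-identity : genSeries isDS ≋ ((poch (⊖ x) w ⊛ poch (⊖ y) w) ⊛ inv (poch z w))
  DS-identity = inv-unique (poch z w) (genSeries isDS) _ poch-z-const
    (≋-truncations λ N i i<N → trans
      (⊛-cong< N (poch-truncated z N) (At.genSeries≈level N isDS) i i<N)
      (trans (At.isDS-product N i i<N) (numerator N i i<N)))

theorem2p5 : ∀ {c ℓ : Level} (R : CommutativeRing c ℓ) (k : ℕ) ⦃ nz : NonZero k ⦄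
    (a b : Fin k → CommutativeRing.Carrier R) →
    let open Series R
        open Thm R k a b
        open Classes k
    in (genSeries isE ≋ inv (poch w w))
    × (genSeries isS ≋ ((poch (⊖ x) w ⊛ poch (⊖ y) w) ⊛ inv (poch z w ⊛ poch w w)))
    × (genSeries isDS ≋ ((poch (⊖ x) w ⊛ poch (⊖ y) w) ⊛ inv (poch z w)))
theorem2p5 R (suc k′) a b = E-identity , S-identity , DS-identity
  where open Assembly R k′ a b
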